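{- Let $G$ be a simple graph with at most $6$ vertices. Then the following three properties are equivalent. 1. $G$ is a circle graph. 2. $G$ has a transverse circuit of size $\leq 3$. 3. $G$ is locally equivalent to a graph with a vertex of degree $\leq 2$.
   Context: All graphs are finite with nonempty vertex set. A 4-regular graph may have loops and multiple edges. An Euler system $C$ of a 4-regular graph $F$ is a set containing precisely one Euler circuit of each connected component of $F$. The interlacement graph $\mathcal{I}(C)$ is the simple graph with vertex set $V(F)$ in which $v\neq w$ are adjacent iff they appear in the cyclic order $v\ldots w\ldots v\ldots w$ on one of the circuits of $C$. A circle graph is a simple graph isomorphic to some $\mathcal{I}(C)$. Local complementation of a simple graph at a vertex $v$ reverses all adjacencies among neighbors of $v$ (edges between neighbors become non-edges and vice versa). Simple graphs are locally equivalent if one can be obtained from the other by a sequence of local complementations. For a simple graph $G$ with adjacency matrix $A$ over $GF(2)$, let $IAS(G)=(I\ \ A\ \ I+A)$ over $GF(2)$, $I$ the $V(G)\times V(G)$ identity matrix. The $v$ columns of $I$, $A$, $I+A$ are labelled $\phi_G(v),\chi_G(v),\psi_G(v)$; $W(G)$ is the set of these $3|V(G)|$ labels, and $M[IAS(G)]$ is the binary matroid on $W(G)$ represented by $IAS(G)$. The vertex triple of $v$ is $\{\phi_G(v),\chi_G(v),\psi_G(v)\}$. A transversal of $W(G)$ is a subset containing exactly one element of each vertex triple. A transverse circuit of $G$ is a matroid circuit of $M[IAS(G)]$ contained in a transversal. -}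

module Defs where

open import Algebra.Bundles using (CommutativeRing)
import Algebra.Properties.CommutativeMonoid.Sum as Sum
open import Data.Bool using (Bool; true; false; not; _∧_; _xor_)
open import Data.Bool.Properties using (xor-∧-commutativeRing; ∧-comm)
open import Data.Empty using (⊥)
open import Data.Fin using (Fin; zero; suc; combine; remQuot; _≟_)
open import Data.Fin.Subset using (Subset; _∈_; _∉_; _⊆_; _⊂_; ∣_∣)
open import Data.List
  using (List; []; _∷_; _∷ʳ_; map; filter; length; lookup; foldl; allFin; cartesianProduct)
import Data.List.Membership.Propositional as Mem
open import Data.List.Relation.Binary.Sublist.Propositional using () renaming (_⊆_ to _⊑_)
import Data.List.Relation.Binary.Sublist.DecPropositional as DecSublist
open import Data.List.Relation.Unary.All using (All)
import Data.List.Relation.Unary.Any as Any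
open Any using (Any)
open import Data.List.Relation.Unary.Linked using (Linked)
open import Data.List.Relation.Unary.Unique.Propositional using (Unique)
open import Data.Nat using (ℕ; NonZero; _*_; _≤_)
open import Data.Product using (Σ; ∃; ∃-syntax; ∃!; _×_; _,_; proj₁; proj₂)
open import Data.Sum using (_⊎_) renaming (swap to ⊎-swap)
open import Data.Vec using (tabulate)
open import Function using (_∘_)
open import Function.Bundles using (_↔_; _⇔_; mk⇔; Inverse)
open import Relation.Binary.Construct.Closure.ReflexiveTransitive using (Star)
open import Relation.Binary.PropositionalEquality
  using (_≡_; _≢_; refl; sym; trans; cong; cong₂; ≢-sym)
open import Relation.Nullary using (Dec; does; ¬_)
open import Relation.Nullary.Decidable using (¬?; _×-dec_; _⊎-dec_; does-⇔; dec-false)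

record SimpleGraph (n : ℕ) : Set where
  field
    adj        : Fin n → Fin n → Bool
    adj-sym    : ∀ u v → adj u v ≡ adj v u
    adj-irrefl : ∀ v → adj v v ≡ false

open SimpleGraph public

infix 4 _≈_ _≅_

_≈_ : ∀ {n} → SimpleGraph n → SimpleGraph n → Set
G ≈ H = ∀ u v → adj G u v ≡ adj H u v

_≅_ : ∀ {m n} → SimpleGraph m → SimpleGraph n → Set
_≅_ {m} {n} G H =
  Σ (Fin m ↔ Fin n) λ f → ∀ u v → adj G u v ≡ adj H (Inverse.to f u) (Inverse.to f v)

degree : ∀ {n} → SimpleGraph n → Fin n → ℕ
degree G v = ∣ tabulate (adj G v) ∣

infixl 6 _✶_

_✶_ : ∀ {n} → SimpleGraph n → Fin n → SimpleGraph n
_✶_ {n} G v = record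
  { adj        = λ u w → adj G u w xor flips u w
  ; adj-sym    = λ u w → cong₂ _xor_ (adj-sym G u w) (flips-sym u w)
  ; adj-irrefl = λ u → cong₂ _xor_ (adj-irrefl G u) (flips-irrefl u)
  }
  where
  distinct : Fin n → Fin n → Bool
  distinct u w = does (¬? (u ≟ w))

  flips : Fin n → Fin n → Bool
  flips u w = distinct u w ∧ (adj G v u ∧ adj G v w)

  flips-sym : ∀ u w → flips u w ≡ flips w u
  flips-sym u w = cong₂ _∧_
    (does-⇔ (mk⇔ ≢-sym ≢-sym) (¬? (u ≟ w)) (¬? (w ≟ u)))
    (∧-comm (adj G v u) (adj G v w))

  flips-irrefl : ∀ u → flips u u ≡ false
  flips-irrefl u =
    cong (_∧ (adj G v u ∧ adj G v u)) (dec-false (¬? (u ≟ u)) (λ u≢u → u≢u refl))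

-- Local complementation at a fixed vertex is an involution, so the direction
-- in which the sequence is applied is immaterial.
LocallyEquivalent : ∀ {n} → SimpleGraph n → SimpleGraph n → Set
LocallyEquivalent {n} G H = Σ (List (Fin n)) λ vs → foldl _✶_ G vs ≈ H

-- Each edge has two half-edges, so that a loop contributes two to the degree
-- of its vertex.  A half-edge (e , b) also serves as the edge e directed from
-- its b-end to its other end.
record MultiGraph : Set where
  field
    order    : ℕ
    size     : ℕ
    nonempty : NonZero order
    end      : Fin size → Bool → Fin order

  Vertex Edge HalfEdge : Set
  Vertex   = Fin order
  Edge     = Fin size
  HalfEdge = Edge × Bool

  edge : HalfEdge → Edge
  edge = proj₁

  source target : HalfEdge → Vertex
  source (e , b) = end e b
  target (e , b) = end e (not b)

  halfEdges : List HalfEdge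
  halfEdges = cartesianProduct (allFin size) (false ∷ true ∷ [])

  valency : Vertex → ℕ
  valency v = length (filter (λ h → source h ≟ v) halfEdges)

  FourRegular : Set
  FourRegular = ∀ v → valency v ≡ 4

  Neighbours : Vertex → Vertex → Set
  Neighbours u v = ∃[ h ] source h ≡ u × target h ≡ v

  Connected : Vertex → Vertex → Set
  Connected = Star Neighbours

  ClosedWalk : List HalfEdge → Set
  ClosedWalk []       = ⊥
  ClosedWalk (h ∷ hs) = Linked (λ h₁ h₂ → target h₁ ≡ source h₂) (h ∷ hs ∷ʳ h)

  -- The two ends of an edge lie in one component, so testing either will do.
  record IsEulerCircuitAt (v : Vertex) (c : List HalfEdge) : Set where
    field
      closed       : ClosedWalk c
      edges-unique : Unique (map edge c)
      edges-cover  : ∀ e → e Mem.∈ map edge c ⇔ Connected v (end e false)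

  -- The circuits of an Euler system are listed in an arbitrary order, each with
  -- an arbitrary starting point and orientation.
  record EulerSystem : Set where
    field
      circuits          : List (List HalfEdge)
      eulerian          : All (λ c → ∃[ v ] IsEulerCircuitAt v c) circuits
      one-per-component :
        ∀ v → ∃! _≡_ λ (i : Fin (length circuits)) → IsEulerCircuitAt v (lookup circuits i)

  open EulerSystem public

  open DecSublist (_≟_ {order}) using () renaming (_⊆?_ to _⊑?_)

  -- Cutting the cyclic order v…w…v…w at an arbitrary point leaves one of the
  -- two linear orders v…w…v…w and w…v…w…v.
  Alternate : Vertex → Vertex → List Vertex → Set
  Alternate v w vs = (v ∷ w ∷ v ∷ w ∷ []) ⊑ vs ⊎ (w ∷ v ∷ w ∷ v ∷ []) ⊑ vs

  Interlaced : EulerSystem → Vertex → Vertex → Set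
  Interlaced C v w = v ≢ w × Any (λ c → Alternate v w (map source c)) (circuits C)

  interlaced? : ∀ C v w → Dec (Interlaced C v w)
  interlaced? C v w = ¬? (v ≟ w) ×-dec
    Any.any? (λ c → ((v ∷ w ∷ v ∷ w ∷ []) ⊑? map source c)
                    ⊎-dec ((w ∷ v ∷ w ∷ v ∷ []) ⊑? map source c)) (circuits C)

  interlaced-sym : ∀ C {v w} → Interlaced C v w → Interlaced C w v
  interlaced-sym C (v≢w , p) = ≢-sym v≢w , Any.map ⊎-swap p

  𝓘 : EulerSystem → SimpleGraph order
  𝓘 C = record
    { adj        = λ v w → does (interlaced? C v w)
    ; adj-sym    = λ v w → does-⇔ (mk⇔ (interlaced-sym C) (interlaced-sym C))
                                  (interlaced? C v w) (interlaced? C w v)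
    ; adj-irrefl = λ v → dec-false (interlaced? C v v) (λ p → proj₁ p refl)
    }

CircleGraph : ∀ {n} → SimpleGraph n → Set
CircleGraph G =
  Σ MultiGraph λ F → MultiGraph.FourRegular F ×
    Σ (MultiGraph.EulerSystem F) λ C → G ≅ MultiGraph.𝓘 F C

module GF2 = CommutativeRing xor-∧-commutativeRing

open GF2 using () renaming (Carrier to 𝔽₂; _+_ to _+₂_; _*_ to _*₂_; 0# to 0₂; 1# to 1₂)
open Sum GF2.+-commutativeMonoid using (sum)

Matrix : ℕ → ℕ → Set
Matrix r m = Fin r → Fin m → 𝔽₂

-- The ground set of the matroid represented by A is its set of column indices,
-- so equal columns at different indices are different elements.
Dependent : ∀ {r m} → Matrix r m → Subset m → Set
Dependent {r} {m} A S =
  Σ (Fin m → 𝔽₂) λ c →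
    (∀ j → j ∉ S → c j ≡ 0₂) ×
    (∃[ j ] c j ≢ 0₂) ×
    (∀ i → sum (λ j → c j *₂ A i j) ≡ 0₂)

Independent : ∀ {r m} → Matrix r m → Subset m → Set
Independent A S = ¬ Dependent A S

MatroidCircuit : ∀ {r m} → Matrix r m → Subset m → Set
MatroidCircuit A S = Dependent A S × (∀ T → T ⊂ S → Independent A T)

-- Column k * n + v of the block matrix (I  A  I+A); for k = 0, 1, 2 the label
-- is φ(v), χ(v), ψ(v) respectively.
label : ∀ {n} → Fin 3 → Fin n → Fin (3 * n)
label = combine

identity : ∀ {n} → Matrix n n
identity i j with does (i ≟ j)
... | true  = 1₂
... | false = 0₂

IAS : ∀ {n} → SimpleGraph n → Matrix n (3 * n)
IAS {n} G i j with remQuot {3} n j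
... | zero         , v = identity i v
... | suc zero     , v = adj G i v
... | suc (suc _)  , v = identity i v +₂ adj G i v

Transversal : ∀ {n} → Subset (3 * n) → Set
Transversal {n} T = ∀ (v : Fin n) → ∃! _≡_ λ k → label k v ∈ T

TransverseCircuit : ∀ {n} → SimpleGraph n → Subset (3 * n) → Set
TransverseCircuit {n} G S =
  MatroidCircuit (IAS G) S × Σ (Subset (3 * n)) λ T → Transversal {n} T × S ⊆ T

{-# OPTIONS --safe #-}

-- All three properties are compared with the existence of a nonzero vector x
-- over GF(2) such that (x , A x) vanishes outside of at most three vertices,
-- where A is the adjacency matrix.
-- Such vectors are the transverse circuits of size at most three, up to
-- minimality, and local complementation only exchanges coordinates within the
-- vertex triples; a greedy sequence of local complementations shrinks x to a
-- single vertex, whose degree is then at most two.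
--
-- Circle graphs are the interlacement graphs of double occurrence words; for
-- these, local complementation at v reverses the part between the two v.  A
-- word traces a 4-regular graph, and a closed trail of at most three edges of
-- it, with the jumps along the word as x, gives the required vector.  Since the
-- word traces around an edge a tree with seven nodes and diameter three, six
-- letters force such a trail.  Conversely every graph on five vertices is given
-- by a word starting with two prescribed letters (a finite search), next to
-- which a sixth letter adjacent to at most these two can be inserted.

module Submission where

open import Defs
open import Algebra.Bundles using (CommutativeMonoid)
import Algebra.Properties.CommutativeMonoid.Sum as CMSum
open import Algebra.Properties.Semiring.Sum GF2.semiring
  using (sum; sum-cong-≗; ∑-distrib-+; *-distribˡ-sum; sum-replicate-zero)
open import Data.Bool using (Bool; true; false; not; _∧_; _∨_; _xor_; if_then_else_; T)
import Data.Bool.Properties as Bool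
open import Data.Bool.Properties
  using (xor-same; xor-identityʳ; ∧-zeroʳ; ∧-conicalˡ; ∧-conicalʳ; ∧-distribʳ-xor; ¬-not; T-≡)
open import Data.Bool.Solver using (module xor-∧-Solver)
open import Data.Empty using (⊥-elim)
open import Data.Fin
  using (Fin; zero; suc; _≟_; _↑ˡ_; _↑ʳ_; splitAt; combine; remQuot; toℕ; fromℕ; inject₁; inject≤)
open import Data.Fin.Patterns using (0F; 1F; 2F; 3F; 4F; 5F; 6F)
open import Data.Fin.Permutation.Components using (transpose; transpose-inverse)
import Data.Fin.Properties as Fin
open import Data.Fin.Properties
  using (any?; all?; remQuot-combine; combine-surjective; inject₁-injective; inject≤-injective;
         fromℕ≢inject₁; toℕ-inject₁)
open import Data.Fin.Subset
  using (Subset; inside; outside; _∈_; _∉_; _⊆_; _⊂_; ∣_∣) renaming (⊥ to ∅)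
open import Data.Fin.Subset.Properties
  using (_∈?_; _⊂?_; p⊂q⇒∣p∣<∣q∣; p⊆q⇒∣p∣≤∣q∣; anySubset?; ⊆-refl; ⊆-trans; ∣⊥∣≡0; ∣p∣≤n)
import Data.List as List
open import Data.List
  using (List; []; _∷_; _∷ʳ_; _++_; map; reverse; mapMaybe; foldl; foldr; filter; length; concat;
         allFin; cartesianProduct)
import Data.List.Membership.Propositional as Mem
open import Data.List.Membership.Propositional.Properties
  using (∈-allFin; ∈-concat⁺′; ∈-concat⁻′; ∈-map⁺; ∈-map⁻; ∈-lookup)
open import Data.List.Membership.Propositional.Properties.WithK using (unique∧set⇒bag)
open import Data.List.Properties
  using (unfold-reverse; map-++; map-tabulate; tabulate-lookup; concat-map; length-map; ++-assoc)
open import Data.List.Relation.Binary.BagAndSetEquality using (∼bag⇒↭)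
open import Data.List.Relation.Binary.Disjoint.Propositional using (Disjoint)
open import Data.List.Relation.Binary.Permutation.Propositional
  using (_↭_; prep; swap) renaming (refl to ↭-refl; trans to ↭-trans)
open import Data.List.Relation.Binary.Permutation.Propositional.Properties
  using () renaming (map⁺ to ↭-map⁺)
import Data.List.Relation.Binary.Sublist.DecPropositional as DecSublist
open import Data.List.Relation.Binary.Sublist.Propositional
  using ([]; _∷_) renaming (_⊆_ to _⊑_; _∷ʳ_ to _∷ˢ_)
open import Data.List.Relation.Binary.Sublist.Propositional.Properties using (++⁺ˡ; ++⁺ʳ; Any-resp-⊆)
open import Data.List.Relation.Unary.All using (All; []; _∷_)
import Data.List.Relation.Unary.All as All
import Data.List.Relation.Unary.All.Properties as All
open import Data.List.Relation.Unary.AllPairs using (AllPairs; []; _∷_)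
import Data.List.Relation.Unary.AllPairs.Properties as AllPairs
open import Data.List.Relation.Unary.Any using (Any; here; there)
import Data.List.Relation.Unary.Any as Any
import Data.List.Relation.Unary.Any.Properties as Any
open import Data.List.Relation.Unary.Linked using (Linked; [-]; _∷_)
open import Data.List.Relation.Unary.Unique.Propositional using (Unique)
import Data.List.Relation.Unary.Unique.Propositional.Properties as Unique
open import Data.List.Relation.Unary.Unique.Propositional.Properties using (allFin⁺; concat⁺)
open import Data.Maybe using (Maybe; just; nothing; maybe)
open import Data.Maybe.Properties using (just-injective)
import Data.Nat as ℕ
open import Data.Nat
  using (ℕ; zero; suc; _+_; _*_; _≤_; _<_; _≡ᵇ_; z≤n; s≤s; s≤s⁻¹; ⌊_/2⌋; NonZero)
open import Data.Nat.Properties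
  using (suc-injective; +-comm; +-suc; +-identityʳ; +-cancelˡ-≡; +-mono-≤; +-0-commutativeMonoid;
         n≡⌊n+n/2⌋; ≡ᵇ⇒≡; ≡⇒≡ᵇ; ≤-trans; ≤-refl; ≤-reflexive; m≤n⇒m≤1+n; n≤1+n; 1+n≢n; n≮0; <⇒≱;
         <-cmp; m≤n⇒m<n∨m≡n)
open import Data.Product using (Σ; ∃; ∃₂; _×_; _,_; proj₁; proj₂)
open import Data.Sum using (_⊎_; inj₁; inj₂)
open import Data.Unit using (⊤; tt)
import Data.Vec as Vec
open import Data.Vec using (Vec; []; _∷_; here; there; lookup; tabulate; toList; fromList; _[_]≔_)
open import Data.Vec.Properties
  using (tabulate-cong; tabulate∘lookup; lookup∘tabulate; lookup⇒[]=; []=⇒lookup; lookup∘update;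
         lookup∘update′; toList-∷ʳ; toList∘fromList)
open import Data.Vec.Relation.Unary.All using ([]; _∷_)
open import Data.Vec.Relation.Unary.AllPairs using ([]; _∷_)
import Data.Vec.Relation.Unary.Unique.Propositional as VecUnique
open import Data.Vec.Relation.Unary.Unique.Propositional.Properties using (lookup-injective)
open import Function using (_∘_; id)
open import Function.Bundles using (_⇔_; mk⇔; Inverse; Equivalence; Injection)
open import Function.Construct.Identity using (↔-id)
open import Function.Properties.Inverse using (↔⇒↣)
open import Relation.Binary.Construct.Closure.ReflexiveTransitive using (Star; ε; _◅_; _◅◅_)
import Relation.Binary.Construct.Closure.ReflexiveTransitive as Star
open import Relation.Binary.Definitions using (tri<; tri≈; tri>)
open import Relation.Binary.PropositionalEquality
  using (_≡_; _≢_; _≗_; refl; sym; trans; cong; cong₂; subst; module ≡-Reasoning)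
open import Relation.Nullary using (Dec; does; yes; no; contradiction; ¬_; invert; Reflects; proof)
open import Relation.Nullary.Decidable
  using (¬?; _×-dec_; _→-dec_; _⊎-dec_; map′; dec-true)

open xor-∧-Solver using (solve; _:=_; _:+_; _:*_; con)

-- Crossings are counted modulo two instead of being read off a subsequence. Parities are additive
-- over concatenation, so that reversal of a segment and insertion of a letter become identities for
-- a Boolean ring solver; subsequences enter only where Euler systems are translated.
--
-- The vector of a closed trail is a discrete derivative. The trail is a 0-1 function on the gaps
-- between consecutive positions of the word, and its change across a position is the same at both
-- occurrences of a letter, because a closed trail has even degree there. Off the corners the
-- function vanishes on both sides of a letter, hence so do its change and the sum of changes
-- between the two occurrences, which is the coordinate of `A x`.
--
-- The constants fit together: two of seven nodes share one of six letters and are at most three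
-- edges apart, and three corners correspond to a vertex with two neighbours. In the converse not
-- every graph on six vertices has a word, so the vertex of degree at most two is set aside and only
-- the other five are searched, with its neighbours among the first two letters.

private
  module ℕΣ = CMSum +-0-commutativeMonoid
  variable
    A B X : Set
    m n : ℕ

-- Double occurrence words and local complementation

-- A structural test: on closed terms it reduces much faster than does (u ≟ v).
infix 5 _==_

_==_ : Fin n → Fin n → Bool
zero  == zero  = true
zero  == suc _ = false
suc _ == zero  = false
suc u == suc v = u == v

==-refl : (u : Fin n) → (u == u) ≡ true
==-refl zero    = refl
==-refl (suc u) = ==-refl u

==⇒≡ : (u v : Fin n) → (u == v) ≡ true → u ≡ v
==⇒≡ zero    zero    _ = refl
==⇒≡ (suc u) (suc v) p = cong suc (==⇒≡ u v p)

≢⇒== : {u v : Fin n} → u ≢ v → (u == v) ≡ false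
≢⇒== {u = u} {v} u≢v = ¬-not (u≢v ∘ ==⇒≡ u v)

==-sym : (u v : Fin n) → (u == v) ≡ (v == u)
==-sym zero    zero    = refl
==-sym zero    (suc v) = refl
==-sym (suc u) zero    = refl
==-sym (suc u) (suc v) = ==-sym u v

count : (A → Bool) → List A → ℕ
count f []       = 0
count f (a ∷ as) = if f a then suc (count f as) else count f as

parity : (A → Bool) → List A → Bool
parity f []       = false
parity f (a ∷ as) = f a xor parity f as

-- The parity of the number of pairs p < q such that f holds at position p and
-- g at position q.  If f and g single out two letters occurring twice each,
-- then it is odd precisely when the letters alternate.
pairs : (A → Bool) → (A → Bool) → List A → Bool
pairs f g []       = false
pairs f g (a ∷ as) = (f a ∧ parity g as) xor pairs f g as

odd : ℕ → Bool
odd zero    = false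
odd (suc k) = not (odd k)

odd-count : (f : A → Bool) → ∀ w → odd (count f w) ≡ parity f w
odd-count f []      = refl
odd-count f (a ∷ w) with f a
... | true  = cong not (odd-count f w)
... | false = odd-count f w

count-++ : (f : A → Bool) → ∀ xs ys → count f (xs ++ ys) ≡ count f xs + count f ys
count-++ f []       ys = refl
count-++ f (x ∷ xs) ys with f x
... | true  = cong suc (count-++ f xs ys)
... | false = count-++ f xs ys

count-skip : (f : A → Bool) {a : A} → f a ≡ false → ∀ w → count f (a ∷ w) ≡ count f w
count-skip f fa w rewrite fa = refl

xor-false : ∀ a {b} → b ≡ false → a xor b ≡ a
xor-false a refl = xor-identityʳ a

parity-++ : (f : A → Bool) → ∀ xs ys → parity f (xs ++ ys) ≡ parity f xs xor parity f ys
parity-++ f []       ys = refl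
parity-++ f (x ∷ xs) ys = trans (cong (f x xor_) (parity-++ f xs ys))
  (solve 3 (λ a b c → a :+ (b :+ c) := (a :+ b) :+ c) refl (f x) (parity f xs) (parity f ys))

pairs-++ : (f g : A → Bool) → ∀ xs ys →
  pairs f g (xs ++ ys) ≡ (pairs f g xs xor pairs f g ys) xor (parity f xs ∧ parity g ys)
pairs-++ f g []       ys = sym (xor-identityʳ _)
pairs-++ f g (x ∷ xs) ys =
  trans (cong₂ (λ a b → (f x ∧ a) xor b) (parity-++ g xs ys) (pairs-++ f g xs ys))
    (solve 6 (λ a b c d e h → (a :* (b :+ c)) :+ ((d :+ e) :+ (h :* c))
                           := (((a :* b) :+ d) :+ e) :+ ((a :+ h) :* c)) refl
      (f x) (parity g xs) (parity g ys) (pairs f g xs) (pairs f g ys) (parity f xs))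

count-reverse : (f : A → Bool) → ∀ w → count f (reverse w) ≡ count f w
count-reverse f []      = refl
count-reverse f (a ∷ w) = begin
  count f (reverse (a ∷ w))                ≡⟨ cong (count f) (unfold-reverse a w) ⟩
  count f (reverse w ∷ʳ a)                 ≡⟨ count-++ f (reverse w) (a ∷ []) ⟩
  count f (reverse w) + count f (a ∷ [])   ≡⟨ cong (_+ count f (a ∷ [])) (count-reverse f w) ⟩
  count f w + count f (a ∷ [])             ≡⟨ +-comm (count f w) _ ⟩
  count f (a ∷ []) + count f w             ≡⟨ sym (count-++ f (a ∷ []) w) ⟩
  count f (a ∷ w)                          ∎
  where open ≡-Reasoning

parity-reverse : (f : A → Bool) → ∀ w → parity f (reverse w) ≡ parity f w
parity-reverse f w = begin
  parity f (reverse w)       ≡⟨ sym (odd-count f (reverse w)) ⟩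
  odd (count f (reverse w))  ≡⟨ cong odd (count-reverse f w) ⟩
  odd (count f w)            ≡⟨ odd-count f w ⟩
  parity f w                 ∎
  where open ≡-Reasoning

Exclusive : (f g : A → Bool) → Set
Exclusive f g = ∀ a → f a ∧ g a ≡ false

==-exclusive : {u v : Fin n} → u ≢ v → Exclusive (u ==_) (v ==_)
==-exclusive {u = u} {v} u≢v a with u == a in p | v == a in q
... | true  | true  = contradiction (trans (==⇒≡ u a p) (sym (==⇒≡ v a q))) u≢v
... | true  | false = refl
... | false | _     = refl

-- Reversal exchanges the pairs with `f` before `g` for those with `g` before `f`. By exclusivity no
-- position satisfies both, so the two kinds together number the product of the two counts.
pairs-reverse : {f g : A → Bool} → Exclusive f g → ∀ w →
  pairs f g (reverse w) ≡ pairs f g w xor (parity f w ∧ parity g w)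
pairs-reverse {f = f} {g} disj []      = refl
pairs-reverse {f = f} {g} disj (a ∷ w) = begin
  pairs f g (reverse (a ∷ w))
    ≡⟨ cong (pairs f g) (unfold-reverse a w) ⟩
  pairs f g (reverse w ∷ʳ a)
    ≡⟨ pairs-++ f g (reverse w) (a ∷ []) ⟩
  (pairs f g (reverse w) xor ((f a ∧ false) xor false)) xor (parity f (reverse w) ∧ (g a xor false))
    ≡⟨ cong₂ (λ x y → (x xor ((f a ∧ false) xor false)) xor (y ∧ (g a xor false)))
         (pairs-reverse disj w) (parity-reverse f w) ⟩
  ((N xor (F ∧ G)) xor ((f a ∧ false) xor false)) xor (F ∧ (g a xor false))
    ≡⟨ solve 5 (λ N F G x y →
         ((N :+ (F :* G)) :+ ((x :* con false) :+ con false)) :+ (F :* (y :+ con false))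
         := (((x :* G) :+ N) :+ ((x :+ F) :* (y :+ G))) :+ (x :* y)) refl N F G (f a) (g a) ⟩
  (((f a ∧ G) xor N) xor ((f a xor F) ∧ (g a xor G))) xor (f a ∧ g a)
    ≡⟨ xor-false _ (disj a) ⟩
  ((f a ∧ G) xor N) xor ((f a xor F) ∧ (g a xor G)) ∎
  where
  open ≡-Reasoning
  N = pairs f g w
  F = parity f w
  G = parity g w

-- The correction vanishes for a letter that occurs an even number of times, which makes crossing
-- symmetric.
pairs-sym : {f g : A → Bool} → Exclusive f g → ∀ w →
  pairs f g w ≡ pairs g f w xor (parity f w ∧ parity g w)
pairs-sym disj [] = refl
pairs-sym {f = f} {g} disj (a ∷ w) = begin
  (f a ∧ G) xor pairs f g w
    ≡⟨ cong ((f a ∧ G) xor_) (pairs-sym disj w) ⟩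
  (f a ∧ G) xor (N xor (F ∧ G))
    ≡⟨ solve 5 (λ N F G x y → (x :* G) :+ (N :+ (F :* G))
         := (((y :* F) :+ N) :+ ((x :+ F) :* (y :+ G))) :+ (x :* y)) refl N F G (f a) (g a) ⟩
  (((g a ∧ F) xor N) xor ((f a xor F) ∧ (g a xor G))) xor (f a ∧ g a)
    ≡⟨ xor-false _ (disj a) ⟩
  ((g a ∧ F) xor N) xor ((f a xor F) ∧ (g a xor G)) ∎
  where
  open ≡-Reasoning
  N = pairs g f w
  F = parity f w
  G = parity g w

count-cong : {f g : A → Bool} → f ≗ g → ∀ w → count f w ≡ count g w
count-cong f≗g []      = refl
count-cong {g = g} f≗g (a ∷ w) rewrite f≗g a | count-cong f≗g w = refl

parity-cong : {f g : A → Bool} → f ≗ g → ∀ w → parity f w ≡ parity g w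
parity-cong f≗g []      = refl
parity-cong f≗g (a ∷ w) = cong₂ _xor_ (f≗g a) (parity-cong f≗g w)

pairs-cong : {f f′ g g′ : A → Bool} → f ≗ f′ → g ≗ g′ → ∀ w → pairs f g w ≡ pairs f′ g′ w
pairs-cong f≗ g≗ []      = refl
pairs-cong f≗ g≗ (a ∷ w) =
  cong₂ _xor_ (cong₂ _∧_ (f≗ a) (parity-cong g≗ w)) (pairs-cong f≗ g≗ w)

module _ (h : A → Maybe B) where

  pull : (B → Bool) → A → Bool
  pull f = maybe f false ∘ h

  count-mapMaybe : ∀ f w → count f (mapMaybe h w) ≡ count (pull f) w
  count-mapMaybe f []      = refl
  count-mapMaybe f (a ∷ w) with h a
  ... | nothing = count-mapMaybe f w
  ... | just b  = cong (λ k → if f b then suc k else k) (count-mapMaybe f w)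

  parity-mapMaybe : ∀ f w → parity f (mapMaybe h w) ≡ parity (pull f) w
  parity-mapMaybe f []      = refl
  parity-mapMaybe f (a ∷ w) with h a
  ... | nothing = parity-mapMaybe f w
  ... | just b  = cong (f b xor_) (parity-mapMaybe f w)

  pairs-mapMaybe : ∀ f g w → pairs f g (mapMaybe h w) ≡ pairs (pull f) (pull g) w
  pairs-mapMaybe f g []      = refl
  pairs-mapMaybe f g (a ∷ w) with h a
  ... | nothing = pairs-mapMaybe f g w
  ... | just b  = cong₂ (λ x y → (f b ∧ x) xor y) (parity-mapMaybe g w) (pairs-mapMaybe f g w)

count-zero⇒parity : (f : A → Bool) → ∀ w → count f w ≡ 0 → parity f w ≡ false
count-zero⇒parity f w p = trans (sym (odd-count f w)) (cong odd p)

count-zero⇒pairs : (f g : A → Bool) → ∀ w → count f w ≡ 0 → pairs f g w ≡ false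
count-zero⇒pairs f g []      p = refl
count-zero⇒pairs f g (a ∷ w) p with f a
... | false = count-zero⇒pairs f g w p

split : (f : A → Bool) → ∀ w {k} → count f w ≡ suc k →
  Σ (List A) λ α → Σ A λ a → Σ (List A) λ β →
    w ≡ α ++ a ∷ β × f a ≡ true × count f α ≡ 0 × count f β ≡ k
split f (a ∷ w) p with f a in fa
... | true  = [] , a , w , refl , fa , refl , suc-injective p
... | false with split f w p
...   | α , b , β , refl , fb , c₀ , c₁ =
        a ∷ α , b , β , refl , fb , trans (count-skip f fa α) c₀ , c₁

-- The diagonal is excluded because a letter occurring twice forms one pair with itself, so that the
-- parity there would be `true`.
record Realises (w : List (Fin n)) (G : SimpleGraph n) : Set where
  field
    twice    : ∀ v → count (v ==_) w ≡ 2
    crossing : ∀ u v → u ≢ v → adj G u v ≡ pairs (u ==_) (v ==_) w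

open Realises public

Realisable : SimpleGraph n → Set
Realisable {n} G = Σ (List (Fin n)) λ w → Realises w G

realisable-≈ : {G H : SimpleGraph n} → G ≈ H → Realisable G → Realisable H
realisable-≈ G≈H (w , r) = w , record
  { twice    = twice r
  ; crossing = λ u v u≢v → trans (sym (G≈H u v)) (crossing r u v u≢v)
  }

-- Deleting the letters outside the image of `ι` keeps the order of the remaining ones.
realisable-induced : {G : SimpleGraph n} {H : SimpleGraph m} (ι : Fin n → Fin m) →
  (∀ {u v} → ι u ≡ ι v → u ≡ v) → (∀ u v → adj G u v ≡ adj H (ι u) (ι v)) →
  Realisable H → Realisable G
realisable-induced {n = n} {m} {G} {H} ι ι-inj adj≡ (w , r) = mapMaybe ρ w , record
  { twice    = λ v → trans (count-mapMaybe ρ (v ==_) w)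
                     (trans (count-cong (pull≗ v) w) (twice r (ι v)))
  ; crossing = λ u v u≢v → trans (adj≡ u v) (trans (crossing r (ι u) (ι v) (u≢v ∘ ι-inj))
                     (sym (trans (pairs-mapMaybe ρ (u ==_) (v ==_) w)
                                 (pairs-cong (pull≗ u) (pull≗ v) w))))
  }
  where
  ρ : Fin m → Maybe (Fin n)
  ρ x with any? (λ u → ι u ≟ x)
  ... | yes (u , _) = just u
  ... | no _        = nothing

  pull≗ : ∀ v → pull ρ (v ==_) ≗ (ι v ==_)
  pull≗ v x with any? (λ u → ι u ≟ x)
  ... | no ∄u = sym (≢⇒== λ ιv≡x → ∄u (v , ιv≡x))
  ... | yes (u , refl) with v ≟ u
  ...   | yes refl = trans (==-refl v) (sym (==-refl (ι v)))
  ...   | no v≢u   = trans (≢⇒== v≢u) (sym (≢⇒== (v≢u ∘ ι-inj)))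

module _ {G : SimpleGraph n} (v : Fin n) (α β γ : List (Fin n))
         (r : Realises (α ++ v ∷ β ++ v ∷ γ) G)
         (α₀ : count (v ==_) α ≡ 0) (β₀ : count (v ==_) β ≡ 0) (γ₀ : count (v ==_) γ ≡ 0)
  where

  -- An occurrence of `t` in `γ` is preceded by both copies of `v`, one in `β` by a single copy and
  -- one in `α` by none, so modulo two only `β` counts.
  parity-between : ∀ t → parity (t ==_) β ≡ adj G v t
  parity-between t with v ≟ t
  ... | yes refl = trans (count-zero⇒parity _ β β₀) (sym (adj-irrefl G v))
  ... | no v≢t   = sym (begin
    adj G v t
      ≡⟨ crossing r v t v≢t ⟩
    pairs f g (α ++ v ∷ β ++ v ∷ γ)
      ≡⟨ pairs-++ f g α _ ⟩
    (pairs f g α xor ((f v ∧ parity g (β ++ v ∷ γ)) xor pairs f g (β ++ v ∷ γ)))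
      xor (parity f α ∧ parity g (v ∷ β ++ v ∷ γ))
      ≡⟨ cong₂ (λ x y → (x xor ((f v ∧ parity g (β ++ v ∷ γ)) xor pairs f g (β ++ v ∷ γ)))
                          xor (y ∧ parity g (v ∷ β ++ v ∷ γ)))
           (count-zero⇒pairs f g α α₀) (count-zero⇒parity f α α₀) ⟩
    ((f v ∧ parity g (β ++ v ∷ γ)) xor pairs f g (β ++ v ∷ γ)) xor false
      ≡⟨ xor-identityʳ _ ⟩
    (f v ∧ parity g (β ++ v ∷ γ)) xor pairs f g (β ++ v ∷ γ)
      ≡⟨ cong₂ (λ x y → (x ∧ parity g (β ++ v ∷ γ)) xor y) (==-refl v) (pairs-++ f g β _) ⟩
    parity g (β ++ v ∷ γ) xor
      ((pairs f g β xor ((f v ∧ parity g γ) xor pairs f g γ)) xor (parity f β ∧ (g v xor parity g γ)))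
      ≡⟨ cong₂ _xor_ (trans (parity-++ g β _) (cong (λ x → parity g β xor (x xor parity g γ)) gv))
           (cong₂ _xor_ (cong₂ _xor_ (count-zero⇒pairs f g β β₀)
             (cong₂ (λ x y → (x ∧ parity g γ) xor y) (==-refl v) (count-zero⇒pairs f g γ γ₀)))
             (cong (_∧ (g v xor parity g γ)) (count-zero⇒parity f β β₀))) ⟩
    (parity g β xor parity g γ) xor ((parity g γ xor false) xor false)
      ≡⟨ solve 2 (λ x y → (x :+ y) :+ ((y :+ con false) :+ con false) := x) refl (parity g β) (parity g γ) ⟩
    parity g β ∎)
    where
    open ≡-Reasoning
    f = v ==_
    g = t ==_
    gv : g v ≡ false
    gv = ≢⇒== (v≢t ∘ sym)

  -- Only pairs with both positions inside `β` change their order.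
  pairs-reverse-between : {f g : Fin n → Bool} → Exclusive f g →
    pairs f g (α ++ v ∷ reverse β ++ v ∷ γ) ≡
    pairs f g (α ++ v ∷ β ++ v ∷ γ) xor (parity f β ∧ parity g β)
  pairs-reverse-between {f} {g} disj = begin
    pairs f g (α ++ v ∷ reverse β ++ v ∷ γ)
      ≡⟨ pairs-++ f g α _ ⟩
    (pairs f g α xor ((f v ∧ parity g (reverse β ++ v ∷ γ)) xor pairs f g (reverse β ++ v ∷ γ)))
      xor (parity f α ∧ (g v xor parity g (reverse β ++ v ∷ γ)))
      ≡⟨ cong₂ (λ x y → (pairs f g α xor ((f v ∧ x) xor y)) xor (parity f α ∧ (g v xor x))) par pai ⟩
    (pairs f g α xor ((f v ∧ P) xor (N xor c))) xor (parity f α ∧ (g v xor P))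
      ≡⟨ solve 5 (λ a b N c d → (a :+ (b :+ (N :+ c))) :+ d := ((a :+ (b :+ N)) :+ d) :+ c) refl
           (pairs f g α) (f v ∧ P) N c (parity f α ∧ (g v xor P)) ⟩
    ((pairs f g α xor ((f v ∧ P) xor N)) xor (parity f α ∧ (g v xor P))) xor c
      ≡⟨ cong (_xor c) (sym (pairs-++ f g α _)) ⟩
    pairs f g (α ++ v ∷ β ++ v ∷ γ) xor c ∎
    where
    open ≡-Reasoning
    P = parity g (β ++ v ∷ γ)
    N = pairs f g (β ++ v ∷ γ)
    c = parity f β ∧ parity g β
    par : parity g (reverse β ++ v ∷ γ) ≡ P
    par = trans (parity-++ g (reverse β) _)
          (trans (cong (_xor _) (parity-reverse g β)) (sym (parity-++ g β _)))
    pai : pairs f g (reverse β ++ v ∷ γ) ≡ N xor c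
    pai = begin
      pairs f g (reverse β ++ v ∷ γ)
        ≡⟨ pairs-++ f g (reverse β) _ ⟩
      (pairs f g (reverse β) xor pairs f g (v ∷ γ)) xor (parity f (reverse β) ∧ parity g (v ∷ γ))
        ≡⟨ cong₂ (λ x y → (x xor pairs f g (v ∷ γ)) xor (y ∧ parity g (v ∷ γ)))
             (pairs-reverse disj β) (parity-reverse f β) ⟩
      ((pairs f g β xor c) xor pairs f g (v ∷ γ)) xor (parity f β ∧ parity g (v ∷ γ))
        ≡⟨ solve 4 (λ a c b d → ((a :+ c) :+ b) :+ d := ((a :+ b) :+ d) :+ c) refl
             (pairs f g β) c (pairs f g (v ∷ γ)) (parity f β ∧ parity g (v ∷ γ)) ⟩
      ((pairs f g β xor pairs f g (v ∷ γ)) xor (parity f β ∧ parity g (v ∷ γ))) xor c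
        ≡⟨ cong (_xor c) (sym (pairs-++ f g β _)) ⟩
      N xor c ∎

  ✶-realises : Realises (α ++ v ∷ reverse β ++ v ∷ γ) (G ✶ v)
  ✶-realises = record
    { twice    = λ t → trans (count-++ (t ==_) α _)
        (trans (cong (count (t ==_) α +_) (cong (λ k → if t == v then suc k else k)
                 (trans (count-++ (t ==_) (reverse β) _)
                   (trans (cong (_+ count (t ==_) (v ∷ γ)) (count-reverse (t ==_) β))
                     (sym (count-++ (t ==_) β _))))))
          (trans (sym (count-++ (t ==_) α _)) (twice r t)))
    ; crossing = λ s t s≢t → sym (trans (pairs-reverse-between (==-exclusive s≢t))
        (cong₂ _xor_ (sym (crossing r s t s≢t))
          (trans (cong₂ _∧_ (parity-between s) (parity-between t)) (sym (flips≡ s t s≢t)))))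
    }
    where
    flips≡ : ∀ s t → s ≢ t → (does (¬? (s ≟ t)) ∧ (adj G v s ∧ adj G v t)) ≡ adj G v s ∧ adj G v t
    flips≡ s t s≢t = cong (_∧ (adj G v s ∧ adj G v t)) (dec-true (¬? (s ≟ t)) s≢t)

realisable-✶ : {G : SimpleGraph n} (v : Fin n) → Realisable G → Realisable (G ✶ v)
realisable-✶ {G = G} v (w , r) with split (v ==_) w (twice r v)
... | α , a , β′ , refl , va , α₀ , c₁ with split (v ==_) β′ c₁
...   | β , b , γ , refl , vb , β₀ , γ₀ with refl ← ==⇒≡ v a va | refl ← ==⇒≡ v b vb =
        α ++ v ∷ reverse β ++ v ∷ γ , ✶-realises v α β γ r α₀ β₀ γ₀

✶-row : (G : SimpleGraph n) (v t : Fin n) → adj (G ✶ v) v t ≡ adj G v t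
✶-row G v t rewrite adj-irrefl G v | ∧-zeroʳ (does (¬? (v ≟ t))) = xor-identityʳ _

✶-involutive : (G : SimpleGraph n) (v : Fin n) → (G ✶ v ✶ v) ≈ G
✶-involutive G v s t rewrite ✶-row G v s | ✶-row G v t =
  solve 2 (λ a b → (a :+ b) :+ b := a) refl (adj G s t) (does (¬? (s ≟ t)) ∧ (adj G v s ∧ adj G v t))

realisable-✶⁻ : {G : SimpleGraph n} (vs : List (Fin n)) → Realisable (foldl _✶_ G vs) → Realisable G
realisable-✶⁻ []       R = R
realisable-✶⁻ {G = G} (v ∷ vs) R = realisable-≈ (✶-involutive G v) (realisable-✶ v (realisable-✶⁻ vs R))

-- Transverse circuits as vectors of small support

[]≔-∣∣ : (p : Subset n) (v : Fin n) → ∣ p [ v ]≔ inside ∣ ≤ suc ∣ p ∣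
[]≔-∣∣ (inside  ∷ p) zero    = s≤s (m≤n⇒m≤1+n ≤-refl)
[]≔-∣∣ (outside ∷ p) zero    = ≤-refl
[]≔-∣∣ (inside  ∷ p) (suc v) = s≤s ([]≔-∣∣ p v)
[]≔-∣∣ (outside ∷ p) (suc v) = []≔-∣∣ p v

∈-[]≔ : (p : Subset n) (v : Fin n) → v ∈ p [ v ]≔ inside
∈-[]≔ p v = lookup⇒[]= v _ (lookup∘update v p inside)

∈-[]≔⁺ : (p : Subset n) (v : Fin n) {u : Fin n} → u ∈ p → u ∈ p [ v ]≔ inside
∈-[]≔⁺ p v {u} u∈p with u ≟ v
... | yes refl = ∈-[]≔ p v
... | no u≢v   = lookup⇒[]= u _ (trans (lookup∘update′ u≢v p inside) ([]=⇒lookup u∈p))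

x∈p⇒0<∣p∣ : (p : Subset n) {x : Fin n} → x ∈ p → 0 < ∣ p ∣
x∈p⇒0<∣p∣ (inside  ∷ p) _         = s≤s z≤n
x∈p⇒0<∣p∣ (outside ∷ p) (there x∈) = x∈p⇒0<∣p∣ p x∈

∈-tabulate⁺ : {f : Fin n → Bool} {v : Fin n} → f v ≡ true → v ∈ tabulate f
∈-tabulate⁺ {f = f} {v} p = lookup⇒[]= v _ (trans (lookup∘tabulate f v) p)

∈-tabulate⁻ : {f : Fin n → Bool} {v : Fin n} → v ∈ tabulate f → f v ≡ true
∈-tabulate⁻ {f = f} {v} p = trans (sym (lookup∘tabulate f v)) ([]=⇒lookup p)

∉-tabulate : {f : Fin n → Bool} {v : Fin n} → v ∉ tabulate f → f v ≡ false
∉-tabulate v∉ = ¬-not (v∉ ∘ ∈-tabulate⁺)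

sum-false : (f : Fin n → Bool) → (∀ v → f v ≡ false) → sum f ≡ false
sum-false {n} f f≡ = trans (sum-cong-≗ f≡) (sum-replicate-zero n)

sum-single : (a : Fin n) (f : Fin n → Bool) → sum (λ u → (a == u) ∧ f u) ≡ f a
sum-single zero    f = xor-false (f zero) (sum-false (λ u → (zero == suc u) ∧ f (suc u)) λ _ → refl)
sum-single (suc a) f = sum-single a (f ∘ suc)

infixr 7 _·_

_·_ : SimpleGraph n → (Fin n → Bool) → Fin n → Bool
(G · x) v = sum λ u → adj G v u ∧ x u

·-≈ : {G H : SimpleGraph n} → G ≈ H → ∀ x v → (G · x) v ≡ (H · x) v
·-≈ G≈H x v = sum-cong-≗ λ u → cong (_∧ x u) (G≈H v u)

·-congʳ : (G : SimpleGraph n) {x y : Fin n → Bool} → (∀ v → x v ≡ y v) → ∀ v → (G · x) v ≡ (G · y) v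
·-congʳ G x≡y v = sum-cong-≗ λ u → cong (adj G v u ∧_) (x≡y u)

·-support : (G : SimpleGraph n) (x : Fin n → Bool) {v : Fin n} → (G · x) v ≡ true → ∃ λ u → x u ≡ true
·-support G x {v} p with any? (λ u → x u Bool.≟ true)
... | yes u = u
... | no ∄u = contradiction
  (trans (sym p) (sum-false _ λ u → trans (cong (adj G v u ∧_) (¬-not λ xu → ∄u (u , xu))) (∧-zeroʳ _))) λ ()

·-single : (G : SimpleGraph n) (a v : Fin n) → (G · (a ==_)) v ≡ adj G v a
·-single G a v = trans (sum-cong-≗ λ u → Bool.∧-comm (adj G v u) (a == u)) (sum-single a (adj G v))

-- The pairs (x , G · x) are the cycle vectors of IAS G; local complementation
-- at a exchanges the coordinates of such vectors within the vertex triples.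
switch : SimpleGraph n → Fin n → (Fin n → Bool) → Fin n → Bool
switch G a x u = x u xor ((a == u) ∧ (G · x) a)

-- Local complementation adds to the matrix the product of column `a` with its transpose, apart from
-- the diagonal. The correction that `switch` makes at `a` cancels the resulting multiple of column
-- `a`; the omitted diagonal leaves the term `adj G a v ∧ x v`.
·-switch : (G : SimpleGraph n) (a : Fin n) (x : Fin n → Bool) → ∀ v →
  ((G ✶ a) · switch G a x) v ≡ (G · x) v xor (adj G a v ∧ x v)
·-switch G a x v = begin
  ((G ✶ a) · switch G a x) v
    ≡⟨ sum-cong-≗ term ⟩
  sum (λ u → (t₁ u xor t₂ u) xor (t₃ u xor t₄ u))
    ≡⟨ trans (∑-distrib-+ (λ u → t₁ u xor t₂ u) (λ u → t₃ u xor t₄ u))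
             (cong₂ _xor_ (∑-distrib-+ t₁ t₂) (∑-distrib-+ t₃ t₄)) ⟩
  (sum t₁ xor sum t₂) xor (sum t₃ xor sum t₄)
    ≡⟨ cong₂ _xor_ (cong (sum t₁ xor_) (sum-single a λ u → adj G v u ∧ y))
         (cong₂ _xor_ (sym (*-distribˡ-sum (adj G a v) λ u → adj G a u ∧ x u))
           (sum-single v λ u → adj G a v ∧ (adj G a u ∧ x u))) ⟩
  ((G · x) v xor (adj G v a ∧ y)) xor ((adj G a v ∧ y) xor (adj G a v ∧ (adj G a v ∧ x v)))
    ≡⟨ cong₂ (λ b c → ((G · x) v xor (b ∧ y)) xor ((adj G a v ∧ y) xor c)) (adj-sym G v a)
         (trans (sym (Bool.∧-assoc (adj G a v) _ _)) (cong (_∧ x v) (Bool.∧-idem (adj G a v)))) ⟩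
  ((G · x) v xor (adj G a v ∧ y)) xor ((adj G a v ∧ y) xor (adj G a v ∧ x v))
    ≡⟨ solve 3 (λ p q r → (p :+ q) :+ (q :+ r) := p :+ r) refl ((G · x) v) (adj G a v ∧ y) (adj G a v ∧ x v) ⟩
  (G · x) v xor (adj G a v ∧ x v) ∎
  where
  open ≡-Reasoning
  y = (G · x) a
  t₁ t₂ t₃ t₄ : Fin _ → Bool
  t₁ u = adj G v u ∧ x u
  t₂ u = (a == u) ∧ (adj G v u ∧ y)
  t₃ u = adj G a v ∧ (adj G a u ∧ x u)
  t₄ u = (v == u) ∧ (adj G a v ∧ (adj G a u ∧ x u))

  distinct≡ : ∀ u → does (¬? (v ≟ u)) ≡ true xor (v == u)
  distinct≡ u with v ≟ u
  ... | yes refl rewrite ==-refl v = refl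
  ... | no v≢u rewrite ≢⇒== v≢u = refl

  diagonal : ∀ u → adj G a u ∧ (a == u) ≡ false
  diagonal u with a ≟ u
  ... | yes refl rewrite adj-irrefl G a = refl
  ... | no a≢u rewrite ≢⇒== a≢u = ∧-zeroʳ _

  term : ∀ u → adj (G ✶ a) v u ∧ switch G a x u ≡ (t₁ u xor t₂ u) xor (t₃ u xor t₄ u)
  term u rewrite distinct≡ u = trans
    (solve 7 (λ A B C d e X Y →
        (A :+ ((con true :+ d) :* (B :* C))) :* (X :+ (e :* Y))
        := (((A :* X) :+ (e :* (A :* Y))) :+ ((B :* (C :* X)) :+ (d :* (B :* (C :* X)))))
           :+ ((C :* e) :* (((con true :+ d) :* B) :* Y)))
      refl (adj G v u) (adj G a v) (adj G a u) (v == u) (a == u) (x u) y)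
    (xor-false _ (cong (_∧ (((true xor (v == u)) ∧ adj G a v) ∧ y)) (diagonal u)))

-- `S` may exceed the support, so that one `S` serves along a whole sequence of local
-- complementations.
record Confined (G : SimpleGraph n) (S : Subset n) : Set where
  field
    vec      : Fin n → Bool
    nonzero  : ∃ λ v → vec v ≡ true
    vec-out  : ∀ {v} → v ∉ S → vec v ≡ false
    prod-out : ∀ {v} → v ∉ S → (G · vec) v ≡ false

open Confined public

module _ {G : SimpleGraph n} {S : Subset n} (X : Confined G S) (a : Fin n) where

  private
    x = vec X

  switch-row : ((G ✶ a) · switch G a x) a ≡ (G · x) a
  switch-row = trans (·-switch G a x a) (xor-false _ (cong (_∧ x a) (adj-irrefl G a)))

  switch-unchanged : (G · x) a ≡ false → ∀ v → switch G a x v ≡ x v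
  switch-unchanged ya v = xor-false (x v) (trans (cong ((a == v) ∧_) ya) (∧-zeroʳ _))

  -- If the product is nonzero at `a`, it remains so, and a vector with nonzero product is nonzero;
  -- otherwise the vector does not change.
  switch-nonzero : ∃ λ v → switch G a x v ≡ true
  switch-nonzero = cases ((G · x) a) refl
    where
    cases : ∀ b → (G · x) a ≡ b → ∃ λ v → switch G a x v ≡ true
    cases true  ya = ·-support (G ✶ a) _ (trans switch-row ya)
    cases false ya = proj₁ (nonzero X) , trans (switch-unchanged ya _) (proj₂ (nonzero X))

  switch-confined : Confined (G ✶ a) S
  switch-confined = record
    { vec      = switch G a x
    ; nonzero  = switch-nonzero
    ; vec-out  = out
    ; prod-out = λ {v} v∉S → trans (·-switch G a x v)
        (cong₂ _xor_ (prod-out X v∉S) (trans (cong (adj G a v ∧_) (vec-out X v∉S)) (∧-zeroʳ _)))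
    }
    where
    out : ∀ {v} → v ∉ S → switch G a x v ≡ false
    out {v} v∉S rewrite vec-out X v∉S with a ≟ v
    ... | yes refl rewrite prod-out X v∉S = ∧-zeroʳ _
    ... | no a≢v rewrite ≢⇒== a≢v = refl

-- Lowering a degree by local complementations

Lowered : SimpleGraph n → Subset n → Set
Lowered {n} G S = Σ (List (Fin n)) λ vs → Σ (Fin n) λ v → degree (foldl _✶_ G vs) v < ∣ S ∣

switch-shrinks : {G : SimpleGraph n} (a : Fin n) {x : Fin n → Bool} → x a ≡ true → (G · x) a ≡ true →
  tabulate (switch G a x) ⊂ tabulate x
switch-shrinks {G = G} a {x} xa ya =
  (λ {u} u∈ → ∈-tabulate⁺ (kept u (∈-tabulate⁻ u∈))) , a , ∈-tabulate⁺ xa , dropped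
  where
  kept : ∀ u → switch G a x u ≡ true → x u ≡ true
  kept u p with a ≟ u
  ... | yes refl = xa
  ... | no a≢u = trans (sym (xor-false (x u) (cong (_∧ (G · x) a) (≢⇒== a≢u)))) p

  dropped : a ∉ tabulate (switch G a x)
  dropped a∈ = contradiction (trans (sym (∈-tabulate⁻ {f = switch G a x} a∈))
    (cong₂ _xor_ xa (cong₂ _∧_ (==-refl a) ya))) λ ()

mutual
  -- Induction on the size of the support of `x`. Complementing at a support vertex `a` where the
  -- product is 1 removes `a` from the support. If there is none, take `a` in the support. A
  -- neighbour `b` with product 0 can be complemented without changing `x`, and this turns the
  -- product at `a` into 1. If there is no such `b`, then all neighbours of `a` have product 1 and
  -- lie in `S`, as does `a` itself, so the degree of `a` is less than the size of `S`.
  lower : ∀ k {G : SimpleGraph n} {S} (X : Confined G S) → ∣ tabulate (vec X) ∣ ≤ k → Lowered G S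
  lower zero X bound = contradiction
    (≤-trans (x∈p⇒0<∣p∣ (tabulate (vec X)) (∈-tabulate⁺ (proj₂ (nonzero X)))) bound) n≮0
  lower (suc k) {G} {S} X bound with any? (λ a → (vec X a Bool.≟ true) ×-dec ((G · vec X) a Bool.≟ true))
  ... | yes (a , xa , ya) = lower-at k X a xa ya bound
  ... | no ∄a with nonzero X
  ...   | a , xa with any? (λ b → (adj G a b Bool.≟ true) ×-dec ((G · vec X) b Bool.≟ false))
  ...     | yes (b , ab , yb) = prepend (lower-at k (switch-confined X b) a
      (trans (switch-unchanged X b yb a) xa)
      (trans (·-switch G b (vec X) a) (cong₂ _xor_ (¬-not λ ya → ∄a (a , xa , ya))
        (cong₂ _∧_ (trans (adj-sym G b a) ab) xa)))
      (subst (λ p → ∣ p ∣ ≤ suc k) (sym (tabulate-cong (switch-unchanged X b yb))) bound))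
    where
    prepend : Lowered (G ✶ b) S → Lowered G S
    prepend (vs , v , deg<) = b ∷ vs , v , deg<
  ...     | no ∄b = [] , a , p⊂q⇒∣p∣<∣q∣ (inside-S , a , a∈S , λ a∈ → contradiction
              (trans (sym (∈-tabulate⁻ {f = adj G a} a∈)) (adj-irrefl G a)) λ ())
    where
    a∈S : a ∈ S
    a∈S with a ∈? S
    ... | yes a∈ = a∈
    ... | no a∉  = contradiction (trans (sym xa) (vec-out X a∉)) λ ()
    inside-S : tabulate (adj G a) ⊆ S
    inside-S {b} b∈ with b ∈? S
    ... | yes b∈S = b∈S
    ... | no b∉S  = contradiction (b , ∈-tabulate⁻ {f = adj G a} b∈ , prod-out X b∉S) ∄b

  lower-at : ∀ k {G : SimpleGraph n} {S} (X : Confined G S) (a : Fin n) →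
    vec X a ≡ true → (G · vec X) a ≡ true → ∣ tabulate (vec X) ∣ ≤ suc k → Lowered G S
  lower-at k {G} X a xa ya bound with lower k (switch-confined X a)
      (s≤s⁻¹ (≤-trans (p⊂q⇒∣p∣<∣q∣ (switch-shrinks {G = G} a xa ya)) bound))
  ... | vs , v , deg< = a ∷ vs , v , deg<

confined-≈ : {G H : SimpleGraph n} {S : Subset n} → G ≈ H → Confined G S → Confined H S
confined-≈ {G = G} {H} G≈H X = record
  { vec      = vec X
  ; nonzero  = nonzero X
  ; vec-out  = vec-out X
  ; prod-out = λ {v} v∉S → trans (sym (·-≈ {G = G} {H} G≈H (vec X) v)) (prod-out X v∉S)
  }

confined-✶⁻ : {G : SimpleGraph n} {S : Subset n} (vs : List (Fin n)) →
  Confined (foldl _✶_ G vs) S → Confined G S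
confined-✶⁻ []               X = X
confined-✶⁻ {G = G} (v ∷ vs) X =
  confined-≈ (✶-involutive G v) (switch-confined (confined-✶⁻ vs X) v)

closedNeighbourhood : SimpleGraph n → Fin n → Subset n
closedNeighbourhood G v = tabulate (adj G v) [ v ]≔ inside

-- The product of the unit vector at `v` is column `v` of the matrix, which is supported on the
-- neighbours of `v`.
confined-neighbourhood : (G : SimpleGraph n) (v : Fin n) → Confined G (closedNeighbourhood G v)
confined-neighbourhood G v = record
  { vec      = v ==_
  ; nonzero  = v , ==-refl v
  ; vec-out  = λ {u} u∉ → ≢⇒== {u = v} {u} λ { refl → u∉ (∈-[]≔ (tabulate (adj G v)) v) }
  ; prod-out = λ {u} u∉ → trans (·-single G v u) (trans (adj-sym G u v)
      (∉-tabulate (u∉ ∘ ∈-[]≔⁺ (tabulate (adj G v)) v)))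
  }

-- Relations among the columns of `IAS G`

module _ {c ℓ} (M : CommutativeMonoid c ℓ) where
  private
    module M = CommutativeMonoid M
    module S = CMSum M

  sum-↑ : ∀ m {n} (f : Fin (m + n) → M.Carrier) →
    S.sum f M.≈ S.sum (λ i → f (i ↑ˡ n)) M.∙ S.sum (λ j → f (m ↑ʳ j))
  sum-↑ zero    f = M.sym (M.identityˡ _)
  sum-↑ (suc m) f = M.trans (M.∙-congˡ (sum-↑ m (f ∘ suc))) (M.sym (M.assoc _ _ _))

  sum-combine : ∀ k (f : Fin (k * n) → M.Carrier) →
    S.sum f M.≈ S.sum λ (i : Fin k) → S.sum λ v → f (combine i v)
  sum-combine     zero    f = M.refl
  sum-combine {n} (suc k) f = M.trans (sum-↑ n f) (M.∙-congˡ (sum-combine k λ j → f (n ↑ʳ j)))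

bit : Bool → ℕ
bit b = if b then 1 else 0

∣tabulate∣ : (f : Fin n → Bool) → ∣ tabulate f ∣ ≡ ℕΣ.sum (bit ∘ f)
∣tabulate∣ {zero}  f = refl
∣tabulate∣ {suc n} f with f zero
... | true  = cong suc (∣tabulate∣ (f ∘ suc))
... | false = ∣tabulate∣ (f ∘ suc)

sum-mono : {f g : Fin n → ℕ} → (∀ i → f i ≤ g i) → ℕΣ.sum f ≤ ℕΣ.sum g
sum-mono {zero}  f≤g = z≤n
sum-mono {suc n} f≤g = +-mono-≤ (f≤g zero) (sum-mono (f≤g ∘ suc))

slices : (f : Fin (3 * n) → Bool) →
  ∣ tabulate f ∣ ≡ ℕΣ.sum {n} λ v → bit (f (label 0F v)) + (bit (f (label 1F v)) + (bit (f (label 2F v)) + 0))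
slices {n} f = begin
  ∣ tabulate f ∣                  ≡⟨ ∣tabulate∣ f ⟩
  ℕΣ.sum (bit ∘ f)                ≡⟨ sum-combine +-0-commutativeMonoid {n} 3 (bit ∘ f) ⟩
  ℕΣ.sum {3} (λ k → ℕΣ.sum {n} λ v → bit (f (label k v)))
                                  ≡⟨ ℕΣ.∑-comm {3} {n} (λ k v → bit (f (label k v))) ⟩
  (ℕΣ.sum {n} λ v → ℕΣ.sum {3} λ k → bit (f (label k v))) ∎
  where open ≡-Reasoning

module _ {r m} (A : Matrix r m) where

  dependent? : ∀ S → Dec (Dependent A S)
  dependent? S = map′ from to (anySubset? λ C →
      all? (λ j → ¬? (j ∈? S) →-dec (lookup C j Bool.≟ false)) ×-dec
      any? (λ j → ¬? (lookup C j Bool.≟ false)) ×-dec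
      all? (λ i → sum (λ j → lookup C j ∧ A i j) Bool.≟ false))
    where
    from : _ → Dependent A S
    from (C , out , nz , zero-sum) = lookup C , out , nz , zero-sum
    to : Dependent A S → _
    to (c , out , (j , cj) , zero-sum) = tabulate c ,
      (λ j j∉ → trans (lookup∘tabulate c j) (out j j∉)) ,
      (j , λ e → cj (trans (sym (lookup∘tabulate c j)) e)) ,
      (λ i → trans (sum-cong-≗ λ j → cong (_∧ A i j) (lookup∘tabulate c j)) (zero-sum i))

  circuit-within : ∀ k S → ∣ S ∣ ≤ k → Dependent A S → ∃ λ C → C ⊆ S × MatroidCircuit A C
  circuit-within k S bound dep with anySubset? (λ T → (T ⊂? S) ×-dec dependent? T)
  ... | no minimal = S , ⊆-refl , dep , λ T T⊂S depT → minimal (T , T⊂S , depT)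
  circuit-within zero    S bound dep | yes (T , T⊂S , depT) =
    contradiction (≤-trans (p⊂q⇒∣p∣<∣q∣ T⊂S) bound) n≮0
  circuit-within (suc k) S bound dep | yes (T , T⊂S@(T⊆S , _) , depT)
    with circuit-within k T (s≤s⁻¹ (≤-trans (p⊂q⇒∣p∣<∣q∣ T⊂S) bound)) depT
  ... | C , C⊆T , circuit = C , ⊆-trans C⊆T T⊆S , circuit

identity-== : (i v : Fin n) → identity i v ≡ (i == v)
identity-== i v with i ≟ v
... | yes refl = sym (==-refl i)
... | no i≢v   = sym (≢⇒== i≢v)

module _ (G : SimpleGraph n) (i : Fin n) where

  IAS-φ : ∀ v → IAS G i (label 0F v) ≡ (i == v)
  IAS-φ v rewrite remQuot-combine {3} 0F v = identity-== i v

  IAS-χ : ∀ v → IAS G i (label 1F v) ≡ adj G i v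
  IAS-χ v rewrite remQuot-combine {3} 1F v = refl

  IAS-ψ : ∀ v → IAS G i (label 2F v) ≡ (i == v) xor adj G i v
  IAS-ψ v rewrite remQuot-combine {3} 2F v = cong (_xor adj G i v) (identity-== i v)

  -- A `ψ` column is the sum of its `φ` and `χ` columns, so a combination of columns splits into one
  -- of the identity with coefficients φ + ψ and one of the adjacency matrix with coefficients χ +
  -- ψ. It vanishes when the former vector is the product of the matrix with the latter.
  IAS-product : (c : Fin (3 * n) → Bool) →
    sum (λ j → c j ∧ IAS G i j) ≡
    (c (label 0F i) xor c (label 2F i)) xor (G · λ v → c (label 1F v) xor c (label 2F v)) i
  IAS-product c = begin
    sum (λ j → c j ∧ IAS G i j)
      ≡⟨ sum-combine GF2.+-commutativeMonoid {n} 3 (λ j → c j ∧ IAS G i j) ⟩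
    sum {3} (λ k → sum {n} λ v → c (label k v) ∧ IAS G i (label k v))
      ≡⟨ CMSum.∑-comm GF2.+-commutativeMonoid {3} {n} (λ k v → c (label k v) ∧ IAS G i (label k v)) ⟩
    sum {n} (λ v → sum {3} λ k → c (label k v) ∧ IAS G i (label k v))
      ≡⟨ sum-cong-≗ {n} column ⟩
    sum {n} (λ v → ((i == v) ∧ z v) xor (adj G i v ∧ x v))
      ≡⟨ ∑-distrib-+ {n} (λ v → (i == v) ∧ z v) (λ v → adj G i v ∧ x v) ⟩
    sum {n} (λ v → (i == v) ∧ z v) xor (G · x) i
      ≡⟨ cong (_xor (G · x) i) (sum-single i z) ⟩
    z i xor (G · x) i ∎
    where
    open ≡-Reasoning
    x z : Fin n → Bool
    x v = c (label 1F v) xor c (label 2F v)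
    z v = c (label 0F v) xor c (label 2F v)

    column : ∀ v → sum {3} (λ k → c (label k v) ∧ IAS G i (label k v)) ≡ ((i == v) ∧ z v) xor (adj G i v ∧ x v)
    column v = trans
      (cong₂ (λ a b → (c (label 0F v) ∧ a) xor b) (IAS-φ v)
        (cong₂ (λ a b → (c (label 1F v) ∧ a) xor ((c (label 2F v) ∧ b) xor false)) (IAS-χ v) (IAS-ψ v)))
      (solve 5 (λ a b d e x → (a :* e) :+ ((b :* x) :+ ((d :* (e :+ x)) :+ con false))
         := (e :* (a :+ d)) :+ (x :* (b :+ d))) refl
         (c (label 0F v)) (c (label 1F v)) (c (label 2F v)) (i == v) (adj G i v))

xor-zero⇒≡ : ∀ a b → a xor b ≡ false → a ≡ b
xor-zero⇒≡ true  true  _ = refl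
xor-zero⇒≡ false false _ = refl

projection : Subset (3 * n) → Subset n
projection S = tabulate λ v → lookup S (label 0F v) ∨ lookup S (label 1F v) ∨ lookup S (label 2F v)

∣projection∣ : (S : Subset (3 * n)) → ∣ projection {n} S ∣ ≤ ∣ S ∣
∣projection∣ {n} S = ≤-trans (≤-reflexive (∣tabulate∣ {n} λ v → l v 0F ∨ l v 1F ∨ l v 2F)) (≤-trans
    (sum-mono {n} λ v → bound (l v 0F) (l v 1F) (l v 2F))
    (≤-reflexive (trans (sym (slices {n} (lookup S))) (cong ∣_∣ (tabulate∘lookup S)))))
  where
  l : Fin n → Fin 3 → Bool
  l v k = lookup S (label k v)
  bound : ∀ a b c → bit (a ∨ b ∨ c) ≤ bit a + (bit b + (bit c + 0))
  bound true  b     c     = s≤s z≤n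
  bound false true  c     = s≤s z≤n
  bound false false true  = s≤s z≤n
  bound false false false = z≤n

∉-projection : (S : Subset (3 * n)) {v : Fin n} → v ∉ projection {n} S → ∀ k → label k v ∉ S
∉-projection {n} S {v} v∉ k kv∈ = v∉ (∈-tabulate⁺ (covers k ([]=⇒lookup kv∈)))
  where
  l : Fin 3 → Bool
  l k = lookup S (label k v)
  covers : ∀ k → l k ≡ true → l 0F ∨ l 1F ∨ l 2F ≡ true
  covers 0F e = cong (_∨ (l 1F ∨ l 2F)) e
  covers 1F e = trans (cong (λ b → l 0F ∨ b ∨ l 2F) e) (Bool.∨-zeroʳ _)
  covers 2F e = trans (cong (λ b → l 0F ∨ l 1F ∨ b) e)
                      (trans (cong (l 0F ∨_) (Bool.∨-zeroʳ _)) (Bool.∨-zeroʳ _))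

module _ {G : SimpleGraph n} {S : Subset (3 * n)} where

  -- The transversal excludes relations such as the sum of the three columns of one vertex triple,
  -- for which `x` would be zero.
  transverse⇒confined : TransverseCircuit G S → Confined G (projection {n} S)
  transverse⇒confined (((c , out , (j , cj) , zero-sum) , _) , T , transversal , S⊆T) = record
    { vec      = x
    ; nonzero  = nz
    ; vec-out  = λ v∉ → cong₂ _xor_ (out _ (∉-projection {n} S v∉ 1F)) (out _ (∉-projection {n} S v∉ 2F))
    ; prod-out = λ {v} v∉ → trans (sym (product v))
                   (cong₂ _xor_ (out _ (∉-projection {n} S v∉ 0F)) (out _ (∉-projection {n} S v∉ 2F)))
    }
    where
    x z : Fin n → Bool
    x v = c (label 1F v) xor c (label 2F v)
    z v = c (label 0F v) xor c (label 2F v)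

    product : ∀ v → z v ≡ (G · x) v
    product v = xor-zero⇒≡ _ _ (trans (sym (IAS-product G v c)) (zero-sum v))

    only : ∀ k k′ v → c (label k v) ≡ true → k ≢ k′ → c (label k′ v) ≡ false
    only k k′ v ck k≢k′ with label k′ v ∈? S
    ... | no k′v∉ = out _ k′v∉
    ... | yes k′v∈ = contradiction (trans (sym (unique (S⊆T kv∈))) (unique (S⊆T k′v∈))) k≢k′
      where
      unique : ∀ {k} → label k v ∈ T → proj₁ (transversal v) ≡ k
      unique = proj₂ (proj₂ (transversal v))
      kv∈ : label k v ∈ S
      kv∈ with label k v ∈? S
      ... | yes kv∈ = kv∈
      ... | no kv∉  = contradiction (trans (sym ck) (out _ kv∉)) λ ()

    nz : ∃ λ v → x v ≡ true
    nz with combine-surjective {3} {n} j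
    ... | k , v , kv≡j = from k (trans (cong c kv≡j) (¬-not cj))
      where
      from : ∀ k → c (label k v) ≡ true → ∃ λ v → x v ≡ true
      -- A `φ` label does not contribute to `x`, but it makes the product nonzero at `v`, so `x` is
      -- nonzero somewhere.
      from 0F e = ·-support G x {v} (trans (sym (product v)) (cong₂ _xor_ e (only 0F 2F v e λ ())))
      from 1F e = v , cong₂ _xor_ e (only 1F 2F v e λ ())
      from 2F e = v , cong₂ _xor_ (only 2F 1F v e λ ()) e

module _ {G : SimpleGraph n} {S : Subset n} (X : Confined G S) where

  private
    x z : Fin n → Bool
    x = vec X
    z = G · x

  -- The column φ, χ or ψ that a vertex with coordinates x and z contributes; the
  -- value φ for x = z = 0 is arbitrary.
  kind : Bool → Bool → Fin 3
  kind false _     = 0F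
  kind true  false = 1F
  kind true  true  = 2F

  kindOf : Fin n → Fin 3
  kindOf v = kind (x v) (z v)

  used : (Fin n → Bool) → Fin 3 × Fin n → Bool
  used f (k , v) = (kindOf v == k) ∧ f v

  support : (Fin n → Bool) → Fin (3 * n) → Bool
  support f j = used f (remQuot {3} n j)

  support-label : ∀ f k v → support f (label k v) ≡ (kindOf v == k) ∧ f v
  support-label f k v = cong (used f) (remQuot-combine {3} k v)

  -- `chosen` takes a label at every vertex in order to be a transversal; `lifted` keeps those over
  -- `S`, which preserves the bound on the size.
  chosen lifted : Subset (3 * n)
  chosen = tabulate (support λ _ → true)
  lifted = tabulate (support (lookup S))

  chosen-transversal : Transversal {n} chosen
  chosen-transversal v = kindOf v ,
    ∈-tabulate⁺ (trans (support-label (λ _ → true) (kindOf v) v) (cong (_∧ true) (==-refl (kindOf v)))) ,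
    λ {k} kv∈ → ==⇒≡ _ _ (trans (sym (Bool.∧-identityʳ _))
      (trans (sym (support-label (λ _ → true) k v)) (∈-tabulate⁻ {f = support λ _ → true} kv∈)))

  lifted⊆chosen : lifted ⊆ chosen
  lifted⊆chosen {j} j∈ = ∈-tabulate⁺ (weaken _ _ (∈-tabulate⁻ {f = support (lookup S)} j∈))
    where
    weaken : ∀ a b → a ∧ b ≡ true → a ∧ true ≡ true
    weaken true _ _ = refl

  ∣lifted∣ : ∣ lifted ∣ ≤ ∣ S ∣
  ∣lifted∣ = ≤-trans (≤-reflexive (slices {n} (support (lookup S)))) (≤-trans
      (sum-mono slice) (≤-reflexive (trans (sym (∣tabulate∣ (lookup S))) (cong ∣_∣ (tabulate∘lookup S)))))
    where
    bound : ∀ (k : Fin 3) b → bit ((k == 0F) ∧ b) + (bit ((k == 1F) ∧ b) + (bit ((k == 2F) ∧ b) + 0)) ≤ bit b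
    bound 0F true  = ≤-refl
    bound 1F true  = ≤-refl
    bound 2F true  = ≤-refl
    bound 0F false = ≤-refl
    bound 1F false = ≤-refl
    bound 2F false = ≤-refl
    slice : ∀ v → bit (support (lookup S) (label 0F v)) + (bit (support (lookup S) (label 1F v))
                  + (bit (support (lookup S) (label 2F v)) + 0)) ≤ bit (lookup S v)
    slice v rewrite support-label (lookup S) 0F v | support-label (lookup S) 1F v | support-label (lookup S) 2F v
      = bound (kindOf v) (lookup S v)

  lifted-dependent : Dependent (IAS G) lifted
  lifted-dependent = c , c-out , c-nonzero , λ i → begin
      sum (λ j → c j ∧ IAS G i j)
        ≡⟨ IAS-product G i c ⟩
      (c (label 0F i) xor c (label 2F i)) xor (G · λ v → c (label 1F v) xor c (label 2F v)) i
        ≡⟨ cong₂ _xor_ (c-z i) (·-congʳ G c-x i) ⟩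
      z i xor z i
        ≡⟨ xor-same (z i) ⟩
      false ∎
    where
    open ≡-Reasoning
    -- This cancels the arbitrary `φ` that `kind` assigns where `x` and `z` are both zero.
    nonzero-at : Fin n → Bool
    nonzero-at v = x v ∨ z v

    c : Fin (3 * n) → Bool
    c = support nonzero-at

    c-x : ∀ v → c (label 1F v) xor c (label 2F v) ≡ x v
    c-x v = trans (cong₂ _xor_ (support-label nonzero-at 1F v) (support-label nonzero-at 2F v)) (χ+ψ (x v) (z v))
      where
      χ+ψ : ∀ a b → ((kind a b == 1F) ∧ (a ∨ b)) xor ((kind a b == 2F) ∧ (a ∨ b)) ≡ a
      χ+ψ true  true  = refl
      χ+ψ true  false = refl
      χ+ψ false b     = refl

    c-z : ∀ v → c (label 0F v) xor c (label 2F v) ≡ z v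
    c-z v = trans (cong₂ _xor_ (support-label nonzero-at 0F v) (support-label nonzero-at 2F v)) (φ+ψ (x v) (z v))
      where
      φ+ψ : ∀ a b → ((kind a b == 0F) ∧ (a ∨ b)) xor ((kind a b == 2F) ∧ (a ∨ b)) ≡ b
      φ+ψ true  true  = refl
      φ+ψ true  false = refl
      φ+ψ false true  = refl
      φ+ψ false false = refl

    c-out : ∀ j → j ∉ lifted → c j ≡ false
    c-out j j∉ = out (remQuot {3} n j) (∉-tabulate {f = support (lookup S)} j∉)
      where
      out : ∀ kv → used (lookup S) kv ≡ false → used nonzero-at kv ≡ false
      out (k , v) unused with v ∈? S
      ... | no v∉  = trans (cong ((kindOf v == k) ∧_) (cong₂ _∨_ (vec-out X v∉) (prod-out X v∉))) (∧-zeroʳ _)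
      ... | yes v∈ = cong (_∧ (x v ∨ z v))
              (trans (sym (Bool.∧-identityʳ _)) (trans (cong ((kindOf v == k) ∧_) (sym ([]=⇒lookup v∈))) unused))

    c-nonzero : ∃ λ j → c j ≢ false
    c-nonzero with nonzero X
    ... | v , xv = label (kindOf v) v , λ e → contradiction (trans (sym e)
      (trans (support-label nonzero-at (kindOf v) v)
        (cong₂ _∧_ (==-refl (kindOf v)) (cong (_∨ z v) xv)))) λ ()

  confined⇒transverse : ∃ λ C → TransverseCircuit G C × ∣ C ∣ ≤ ∣ S ∣
  confined⇒transverse =
    let C , C⊆lifted , circuit = circuit-within (IAS G) ∣ lifted ∣ lifted ≤-refl lifted-dependent
    in C , (circuit , chosen , chosen-transversal , ⊆-trans C⊆lifted lifted⊆chosen) ,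
       ≤-trans (p⊆q⇒∣p∣≤∣q∣ C⊆lifted) ∣lifted∣

-- Words of Euler systems

mapMaybe-⊑ : (h : A → Maybe B) {xs ys : List A} → xs ⊑ ys → mapMaybe h xs ⊑ mapMaybe h ys
mapMaybe-⊑ h []         = []
mapMaybe-⊑ h (y ∷ˢ p) with h y
... | nothing = mapMaybe-⊑ h p
... | just c  = c ∷ˢ mapMaybe-⊑ h p
mapMaybe-⊑ h (_∷_ {x = x} refl p) with h x
... | nothing = mapMaybe-⊑ h p
... | just c  = refl ∷ mapMaybe-⊑ h p

Alternating : A → A → List A → Set
Alternating u v w = (u ∷ v ∷ u ∷ v ∷ []) ⊑ w ⊎ (v ∷ u ∷ v ∷ u ∷ []) ⊑ w

alternating? : ∀ q → Dec (Alternating true false q)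
alternating? q = ((true ∷ false ∷ true ∷ false ∷ []) ⊑? q) ⊎-dec ((false ∷ true ∷ false ∷ true ∷ []) ⊑? q)
  where open DecSublist Bool._≟_ renaming (_⊆?_ to _⊑?_)

count-id+not : ∀ q → count id q + count not q ≡ length q
count-id+not []          = refl
count-id+not (true ∷ q)  = cong suc (count-id+not q)
count-id+not (false ∷ q) = trans (+-suc (count id q) (count not q)) (cong suc (count-id+not q))

-- Length and counts leave only six Boolean words, on which both sides evaluate.
pairs-alternating? : ∀ q → length q ≡ 4 → count id q ≡ 2 → count not q ≡ 2 →
  pairs id not q ≡ does (alternating? q)
pairs-alternating? (true  ∷ true  ∷ false ∷ false ∷ []) _ _ _ = refl
pairs-alternating? (true  ∷ false ∷ true  ∷ false ∷ []) _ _ _ = refl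
pairs-alternating? (true  ∷ false ∷ false ∷ true  ∷ []) _ _ _ = refl
pairs-alternating? (false ∷ true  ∷ true  ∷ false ∷ []) _ _ _ = refl
pairs-alternating? (false ∷ true  ∷ false ∷ true  ∷ []) _ _ _ = refl
pairs-alternating? (false ∷ false ∷ true  ∷ true  ∷ []) _ _ _ = refl

module _ {n} {u v : Fin n} (u≢v : u ≢ v) where

  private
    side : Fin n → Maybe Bool
    side x = if u == x then just true else if v == x then just false else nothing

    letter : Bool → Fin n
    letter b = if b then u else v

  side-u : pull side id ≗ (u ==_)
  side-u x with u == x | v == x
  ... | true  | _     = refl
  ... | false | true  = refl
  ... | false | false = refl

  side-v : pull side not ≗ (v ==_)
  side-v x with u == x in ux | v == x in vx
  ... | true  | true  = contradiction (trans (==⇒≡ u x ux) (sym (==⇒≡ v x vx))) u≢v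
  ... | true  | false = refl
  ... | false | true  = refl
  ... | false | false = refl

  side-letter : ∀ x b → side x ≡ just b → letter b ≡ x
  side-letter x b e with u == x in ux | v == x in vx
  side-letter x true  refl | true  | _    = ==⇒≡ u x ux
  side-letter x false refl | false | true = ==⇒≡ v x vx

  letter-side : ∀ b → side (letter b) ≡ just b
  letter-side true rewrite ==-refl u = refl
  letter-side false rewrite ≢⇒== u≢v | ==-refl v = refl

  lift-⊑ : ∀ {xs} w → xs ⊑ mapMaybe side w → map letter xs ⊑ w
  lift-⊑ [] [] = []
  lift-⊑ (x ∷ w) xs⊑ with side x in e
  ... | nothing = x ∷ˢ lift-⊑ w xs⊑
  lift-⊑ (x ∷ w) (_ ∷ˢ xs⊑)   | just b = x ∷ˢ lift-⊑ w xs⊑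
  lift-⊑ (x ∷ w) (refl ∷ xs⊑) | just b = side-letter x b e ∷ lift-⊑ w xs⊑

  side-map : ∀ bs → mapMaybe side (map letter bs) ≡ bs
  side-map []       = refl
  side-map (b ∷ bs) rewrite letter-side b = cong (b ∷_) (side-map bs)

  lower-⊑ : ∀ {bs w} → map letter bs ⊑ w → bs ⊑ mapMaybe side w
  lower-⊑ {bs} p = subst (_⊑ _) (side-map bs) (mapMaybe-⊑ side p)

  -- Erasing all letters except `u` and `v` affects neither side and reduces the claim to Boolean
  -- words of length four.
  alternating⇔pairs : ∀ w → count (u ==_) w ≡ 2 → count (v ==_) w ≡ 2 →
    Alternating u v w ⇔ (pairs (u ==_) (v ==_) w ≡ true)
  alternating⇔pairs w u₂ v₂ = mk⇔
      (λ alt → trans pairs≡ (dec-true (alternating? q) (down alt)))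
      (λ p → up (invert (subst (Reflects _) (trans (sym pairs≡) p) (proof (alternating? q)))))
    where
    q : List Bool
    q = mapMaybe side w

    pairs≡ : pairs (u ==_) (v ==_) w ≡ does (alternating? q)
    pairs≡ = begin
      pairs (u ==_) (v ==_) w                  ≡⟨ sym (pairs-cong side-u side-v w) ⟩
      pairs (pull side id) (pull side not) w   ≡⟨ sym (pairs-mapMaybe side id not w) ⟩
      pairs id not q
        ≡⟨ pairs-alternating? q (trans (sym (count-id+not q)) (cong₂ _+_ q₁ q₂)) q₁ q₂ ⟩
      does (alternating? q)                    ∎
      where
      open ≡-Reasoning
      q₁ : count id q ≡ 2
      q₁ = trans (count-mapMaybe side id w) (trans (count-cong side-u w) u₂)
      q₂ : count not q ≡ 2
      q₂ = trans (count-mapMaybe side not w) (trans (count-cong side-v w) v₂)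

    down : Alternating u v w → Alternating true false q
    down (inj₁ p) = inj₁ (lower-⊑ p)
    down (inj₂ p) = inj₂ (lower-⊑ p)

    up : Alternating true false q → Alternating u v w
    up (inj₁ p) = inj₁ (lift-⊑ w p)
    up (inj₂ p) = inj₂ (lift-⊑ w p)

≡does : {P : Set} (b : Bool) (d : Dec P) → P ⇔ (b ≡ true) → b ≡ does d
≡does b     (yes p) P⇔b = Equivalence.to P⇔b p
≡does false (no ¬p) P⇔b = refl
≡does true  (no ¬p) P⇔b = contradiction (Equivalence.from P⇔b refl) ¬p

count-↭ : (f : A → Bool) {xs ys : List A} → xs ↭ ys → count f xs ≡ count f ys
count-↭ f ↭-refl = refl
count-↭ f (prep x p) with f x
... | true  = cong suc (count-↭ f p)
... | false = count-↭ f p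
count-↭ f (swap x y p) with f x | f y
... | true  | true  = cong (2 +_) (count-↭ f p)
... | true  | false = cong suc (count-↭ f p)
... | false | true  = cong suc (count-↭ f p)
... | false | false = count-↭ f p
count-↭ f (↭-trans p q) = trans (count-↭ f p) (count-↭ f q)

module _ (F : MultiGraph) where
  open MultiGraph F

  valency-ends : ∀ v es → length (filter (λ h → source h ≟ v) (cartesianProduct es (false ∷ true ∷ []))) ≡
    count (v ==_) (map (λ e → end e false) es) + count (v ==_) (map (λ e → end e true) es)
  valency-ends v []       = refl
  valency-ends v (e ∷ es) = begin
    length (filter P? ((e , false) ∷ (e , true) ∷ cartesianProduct es (false ∷ true ∷ [])))
      ≡⟨ step (e , false) _ ⟩
    bump (e , false) (length (filter P? ((e , true) ∷ cartesianProduct es (false ∷ true ∷ []))))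
      ≡⟨ cong (bump (e , false)) (trans (step (e , true) _) (cong (bump (e , true)) (valency-ends v es))) ⟩
    bump (e , false) (bump (e , true)
        (count (v ==_) (map (λ e → end e false) es) + count (v ==_) (map (λ e → end e true) es)))
      ≡⟨ shuffle (v == end e false) (v == end e true) _ _ ⟩
    count (v ==_) (map (λ e → end e false) (e ∷ es)) + count (v ==_) (map (λ e → end e true) (e ∷ es)) ∎
    where
    open ≡-Reasoning
    P? = λ h → source h ≟ v

    bump : HalfEdge → ℕ → ℕ
    bump h k = if v == source h then suc k else k

    step : ∀ h hs → length (filter P? (h ∷ hs)) ≡ bump h (length (filter P? hs))
    step h hs with source h ≟ v
    ... | yes refl rewrite ==-refl (source h) = refl
    ... | no h≢v rewrite ≢⇒== (h≢v ∘ sym) = refl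

    shuffle : ∀ a b x y →
      (if a then suc (if b then suc (x + y) else x + y) else if b then suc (x + y) else x + y) ≡
      (if a then suc x else x) + (if b then suc y else y)
    shuffle true  true  x y = cong suc (sym (+-suc x y))
    shuffle true  false x y = refl
    shuffle false true  x y = sym (+-suc x y)
    shuffle false false x y = refl

  connected-sym : ∀ {u v} → Connected u v → Connected v u
  connected-sym = Star.reverse flip
    where
    flip : ∀ {u v} → Neighbours u v → Neighbours v u
    flip ((e , b) , refl , refl) = (e , not b) , refl , cong (end e) (Bool.not-involutive b)

  connected-source : ∀ e b → Connected (end e false) (end e b)
  connected-source e false = ε
  connected-source e true  = ((e , false) , refl , refl) ◅ ε

  euler-transport : ∀ {u v c} → Connected u v → IsEulerCircuitAt u c → IsEulerCircuitAt v c
  euler-transport u~v E = record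
    { closed       = closed
    ; edges-unique = edges-unique
    ; edges-cover  = λ e → mk⇔ (λ e∈ → connected-sym u~v ◅◅ Equivalence.to (edges-cover e) e∈)
                               (λ v~e → Equivalence.from (edges-cover e) (u~v ◅◅ v~e))
    }
    where open IsEulerCircuitAt E

  -- Along a closed walk the targets are the sources shifted cyclically by one place.
  closed-walk-ends : ∀ {f} c → ClosedWalk c → count f (map target c) ≡ count f (map source c)
  closed-walk-ends {f} (h ∷ hs) linked = begin
    count f (map target (h ∷ hs))                   ≡⟨ cong (count f) (shift h hs linked) ⟩
    count f (map source hs ∷ʳ source h)             ≡⟨ count-++ f (map source hs) _ ⟩
    count f (map source hs) + count f (source h ∷ [])
                                                    ≡⟨ +-comm (count f (map source hs)) _ ⟩
    count f (source h ∷ []) + count f (map source hs)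
                                                    ≡⟨ sym (count-++ f (source h ∷ []) (map source hs)) ⟩
    count f (map source (h ∷ hs))                   ∎
    where
    open ≡-Reasoning
    shift : ∀ g gs {k} → Linked (λ h₁ h₂ → target h₁ ≡ source h₂) (g ∷ gs ∷ʳ k) →
            map target (g ∷ gs) ≡ map source gs ∷ʳ source k
    shift g []        (e ∷ _)  = cong (_∷ []) e
    shift g (g′ ∷ gs) (e ∷ es) = cong₂ _∷_ e (shift g′ gs es)

  -- A half-edge and its reverse have the same two ends, so the directions in which the edges are
  -- traversed drop out.
  count-half-edges : ∀ f hs → count f (map source hs) + count f (map target hs) ≡
    count f (map (λ e → end e false) (map edge hs)) + count f (map (λ e → end e true) (map edge hs))
  count-half-edges f []             = refl
  count-half-edges f ((e , b) ∷ hs) = step b (count-half-edges f hs)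
    where
    bump : Bool → ℕ → ℕ
    bump x k = if x then suc k else k

    bump-+ : ∀ x y {a b c d} → a + b ≡ c + d → bump x a + bump y b ≡ bump x c + bump y d
    bump-+ true  true  {a} {b} {c} {d} p = cong suc (trans (+-suc a b) (trans (cong suc p) (sym (+-suc c d))))
    bump-+ true  false p = cong suc p
    bump-+ false true  {a} {b} {c} {d} p = trans (+-suc a b) (trans (cong suc p) (sym (+-suc c d)))
    bump-+ false false p = p

    step : ∀ b {a₁ a₂ a₃ a₄} → a₁ + a₂ ≡ a₃ + a₄ →
      bump (f (end e b)) a₁ + bump (f (end e (not b))) a₂ ≡ bump (f (end e false)) a₃ + bump (f (end e true)) a₄
    step false p = bump-+ (f (end e false)) (f (end e true)) p
    step true {a₁} {a₂} {a₃} {a₄} p = trans (+-comm (bump (f (end e true)) a₁) _)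
      (bump-+ (f (end e false)) (f (end e true)) (trans (+-comm a₂ a₁) p))

++-⊑ : {xs : List A} → ∀ l {r} → xs ⊑ l ++ r → ∃₂ λ as bs → xs ≡ as ++ bs × as ⊑ l × bs ⊑ r
++-⊑ []      p = [] , _ , refl , [] , p
++-⊑ (x ∷ l) (.x ∷ˢ p) with ++-⊑ l p
... | as , bs , refl , p₁ , p₂ = as , bs , refl , x ∷ˢ p₁ , p₂
++-⊑ (x ∷ l) (refl ∷ p) with ++-⊑ l p
... | as , bs , refl , p₁ , p₂ = x ∷ as , bs , refl , refl ∷ p₁ , p₂

module _ {u v : A} where

  -- Every proper cut of the pattern u v u v leaves one of the two letters on both sides.
  alternation-in : ∀ l {r} → Disjoint l r → (u ∷ v ∷ u ∷ v ∷ []) ⊑ l ++ r →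
    (u ∷ v ∷ u ∷ v ∷ []) ⊑ l ⊎ (u ∷ v ∷ u ∷ v ∷ []) ⊑ r
  alternation-in l disj p with ++-⊑ l p
  ... | []                     , _ , refl , p₁ , p₂ = inj₂ p₂
  ... | _ ∷ []                 , _ , refl , p₁ , p₂ =
    ⊥-elim (disj (Any-resp-⊆ p₁ (here refl) , Any-resp-⊆ p₂ (there (here refl))))
  ... | _ ∷ _ ∷ []             , _ , refl , p₁ , p₂ =
    ⊥-elim (disj (Any-resp-⊆ p₁ (here refl) , Any-resp-⊆ p₂ (here refl)))
  ... | _ ∷ _ ∷ _ ∷ []         , _ , refl , p₁ , p₂ =
    ⊥-elim (disj (Any-resp-⊆ p₁ (there (here refl)) , Any-resp-⊆ p₂ (here refl)))
  ... | _ ∷ _ ∷ _ ∷ _ ∷ []     , _ , refl , p₁ , p₂ = inj₁ p₁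

  alternation-concat : ∀ ls → AllPairs Disjoint ls → (u ∷ v ∷ u ∷ v ∷ []) ⊑ concat ls →
    Any ((u ∷ v ∷ u ∷ v ∷ []) ⊑_) ls
  alternation-concat (l ∷ ls) (disj ∷ disjs) p with alternation-in l apart p
    where
    apart : Disjoint l (concat ls)
    apart (x∈l , x∈ls) with ∈-concat⁻′ ls x∈ls
    ... | l′ , x∈l′ , l′∈ls = All.lookup disj l′∈ls (x∈l , x∈l′)
  ... | inj₁ p₁ = here p₁
  ... | inj₂ p₂ = there (alternation-concat ls disjs p₂)

⊑-concat : {xs : List A} → ∀ {ls} → Any (xs ⊑_) ls → xs ⊑ concat ls
⊑-concat {ls = l ∷ ls} (here p)  = ++⁺ʳ (concat ls) p
⊑-concat {ls = l ∷ ls} (there p) = ++⁺ˡ l (⊑-concat p)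

module _ (F : MultiGraph) (regular : MultiGraph.FourRegular F) (C : MultiGraph.EulerSystem F) where
  open MultiGraph F

  private
    cs = circuits C

  eulerian-at : ∀ i → ∃ λ v → IsEulerCircuitAt v (List.lookup cs i)
  eulerian-at i = All.lookup (eulerian C) (∈-lookup i)

  same-circuit : ∀ i j {x} → Connected (proj₁ (eulerian-at i)) x → Connected (proj₁ (eulerian-at j)) x → i ≡ j
  same-circuit i j {x} i~x j~x = trans (sym (unique (euler-transport F i~x (proj₂ (eulerian-at i)))))
                                            (unique (euler-transport F j~x (proj₂ (eulerian-at j))))
    where
    unique : ∀ {k} → IsEulerCircuitAt x (List.lookup cs k) → proj₁ (one-per-component C x) ≡ k
    unique = proj₂ (proj₂ (one-per-component C x))

  edge-connected : ∀ i {e} → e Mem.∈ map edge (List.lookup cs i) → Connected (proj₁ (eulerian-at i)) (end e false)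
  edge-connected i {e} = Equivalence.to (IsEulerCircuitAt.edges-cover (proj₂ (eulerian-at i)) e)

  source-connected : ∀ i {x} → x Mem.∈ map source (List.lookup cs i) → Connected (proj₁ (eulerian-at i)) x
  source-connected i x∈ with ∈-map⁻ source x∈
  ... | (e , b) , h∈ , refl = edge-connected i (∈-map⁺ edge h∈) ◅◅ connected-source F e b

  apart : {X : Set} (f : HalfEdge → X) →
    (∀ {i j x} → x Mem.∈ map f (List.lookup cs i) → x Mem.∈ map f (List.lookup cs j) → i ≡ j) →
    AllPairs Disjoint (map (map f) cs)
  apart f same = subst (AllPairs Disjoint)
    (trans (sym (map-tabulate (List.lookup cs) (map f))) (cong (map (map f)) (tabulate-lookup cs)))
    (AllPairs.tabulate⁺ λ {i} {j} i≢j (x∈i , x∈j) → i≢j (same x∈i x∈j))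

  edges : List Edge
  edges = map edge (concat cs)

  edges-!  : Unique edges
  edges-! = subst Unique (concat-map cs) (concat⁺
    (All.map⁺ (All.map (λ (v , E) → IsEulerCircuitAt.edges-unique E) (eulerian C)))
    (apart edge λ {i} {j} e∈i e∈j → same-circuit i j (edge-connected i e∈i) (edge-connected j e∈j)))

  edges-complete : ∀ e → e Mem.∈ edges
  edges-complete e with one-per-component C (end e false)
  ... | i , E , _ = subst (e Mem.∈_) (concat-map cs) (∈-concat⁺′
    (Equivalence.from (IsEulerCircuitAt.edges-cover E e) ε) (∈-map⁺ (map edge) (∈-lookup {xs = cs} i)))

  edges-↭ : edges ↭ allFin size
  edges-↭ = ∼bag⇒↭ (unique∧set⇒bag edges-! (allFin⁺ size)
    (λ {e} → mk⇔ (λ _ → ∈-allFin e) (λ _ → edges-complete e)))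

  -- Circuits of different components share no letter, so concatenating them creates no alternation.
  word : List Vertex
  word = map source (concat cs)

  sources≡targets : ∀ f → count f (map target (concat cs)) ≡ count f word
  sources≡targets f = go cs (eulerian C)
    where
    go : ∀ ds → All (λ c → ∃ λ v → IsEulerCircuitAt v c) ds →
         count f (map target (concat ds)) ≡ count f (map source (concat ds))
    go []       [] = refl
    go (d ∷ ds) ((v , E) ∷ Es) = begin
      count f (map target (d ++ concat ds))
        ≡⟨ trans (cong (count f) (map-++ target d _)) (count-++ f (map target d) _) ⟩
      count f (map target d) + count f (map target (concat ds))
        ≡⟨ cong₂ _+_ (closed-walk-ends F d (IsEulerCircuitAt.closed E)) (go ds Es) ⟩
      count f (map source d) + count f (map source (concat ds))
        ≡⟨ sym (trans (cong (count f) (map-++ source d _)) (count-++ f (map source d) _)) ⟩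
      count f (map source (d ++ concat ds)) ∎
      where open ≡-Reasoning

  -- The circuits use every edge once, so the sources and targets equal to `v` together number the
  -- valency four; as the circuits are closed, half of them are sources.
  word-twice : ∀ v → count (v ==_) word ≡ 2
  word-twice v = trans (n≡⌊n+n/2⌋ _) (cong ⌊_/2⌋ (begin
    count (v ==_) word + count (v ==_) word
      ≡⟨ cong (count (v ==_) word +_) (sym (sources≡targets (v ==_))) ⟩
    count (v ==_) word + count (v ==_) (map target (concat cs))
      ≡⟨ count-half-edges F (v ==_) (concat cs) ⟩
    count (v ==_) (map (λ e → end e false) edges) + count (v ==_) (map (λ e → end e true) edges)
      ≡⟨ cong₂ _+_ (count-↭ (v ==_) (↭-map⁺ _ edges-↭)) (count-↭ (v ==_) (↭-map⁺ _ edges-↭)) ⟩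
    count (v ==_) (map (λ e → end e false) (allFin size)) + count (v ==_) (map (λ e → end e true) (allFin size))
      ≡⟨ sym (valency-ends F v (allFin size)) ⟩
    valency v
      ≡⟨ regular v ⟩
    4 ∎))
    where open ≡-Reasoning

  interlaced⇔alternating : ∀ {u v} → Any (λ c → Alternate u v (map source c)) cs ⇔ Alternating u v word
  interlaced⇔alternating {u} {v} = mk⇔ to from
    where
    word≡ : concat (map (map source) cs) ≡ word
    word≡ = concat-map cs

    apart-sources : AllPairs Disjoint (map (map source) cs)
    apart-sources = apart source λ {i} {j} x∈i x∈j →
      same-circuit i j (source-connected i x∈i) (source-connected j x∈j)

    to : Any (λ c → Alternate u v (map source c)) cs → Alternating u v word
    to p with Any.Any-⊎⁻ p
    ... | inj₁ q = inj₁ (subst (_ ⊑_) word≡ (⊑-concat (Any.map⁺ q)))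
    ... | inj₂ q = inj₂ (subst (_ ⊑_) word≡ (⊑-concat (Any.map⁺ q)))

    from : Alternating u v word → Any (λ c → Alternate u v (map source c)) cs
    from (inj₁ p) = Any.map inj₁ (Any.map⁻ (alternation-concat _ apart-sources (subst (_ ⊑_) (sym word≡) p)))
    from (inj₂ p) = Any.map inj₂ (Any.map⁻ (alternation-concat _ apart-sources (subst (_ ⊑_) (sym word≡) p)))

  word-realises : Realises word (𝓘 C)
  word-realises = record
    { twice    = word-twice
    ; crossing = λ u v u≢v → sym (≡does (pairs (u ==_) (v ==_) word) (interlaced? C u v)
        (mk⇔ (λ (_ , alt) → Equivalence.to (alternating⇔ u v u≢v) (Equivalence.to interlaced⇔alternating alt))
             (λ p → u≢v , Equivalence.from interlaced⇔alternating (Equivalence.from (alternating⇔ u v u≢v) p))))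
    }
    where
    alternating⇔ : ∀ u v → u ≢ v → Alternating u v word ⇔ (pairs (u ==_) (v ==_) word ≡ true)
    alternating⇔ u v u≢v = alternating⇔pairs u≢v word (word-twice u) (word-twice v)

circle⇒realisable : {G : SimpleGraph n} → CircleGraph G → Realisable G
circle⇒realisable (F , regular , C , f , adj≡) =
  realisable-induced (Inverse.to f) (Injection.injective (↔⇒↣ f)) adj≡
    (word F regular C , word-realises F regular C)

-- Euler circuits traced by words

lookup-∷ʳ-inject₁ : (xs : Vec A m) (x : A) (i : Fin m) → Vec.lookup (xs Vec.∷ʳ x) (inject₁ i) ≡ Vec.lookup xs i
lookup-∷ʳ-inject₁ (_ ∷ xs) x zero    = refl
lookup-∷ʳ-inject₁ (_ ∷ xs) x (suc i) = lookup-∷ʳ-inject₁ xs x i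

lookup-∷ʳ-fromℕ : (xs : Vec A m) (x : A) → Vec.lookup (xs Vec.∷ʳ x) (fromℕ m) ≡ x
lookup-∷ʳ-fromℕ []       x = refl
lookup-∷ʳ-fromℕ (_ ∷ xs) x = lookup-∷ʳ-fromℕ xs x

tabulate-lookup-toList : (xs : Vec A m) → List.tabulate (Vec.lookup xs) ≡ toList xs
tabulate-lookup-toList []       = refl
tabulate-lookup-toList (x ∷ xs) = cong (x ∷_) (tabulate-lookup-toList xs)

tabulate-linked : {R : A → A → Set} (h : Fin (suc m) → A) {k : A} →
  (∀ i → R (h (inject₁ i)) (h (suc i))) → R (h (fromℕ m)) k → Linked R (List.tabulate h ∷ʳ k)
tabulate-linked {m = zero}  h step last = last ∷ [-]
tabulate-linked {m = suc m} h step last = step zero ∷ tabulate-linked (h ∘ suc) (step ∘ suc) last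

star-chain : {R : A → A → Set} (s : Fin (suc m) → A) → (∀ i → R (s (inject₁ i)) (s (suc i))) →
  ∀ i → Star R (s zero) (s i)
star-chain s step zero = ε
star-chain {m = suc m} s step (suc i) = step zero ◅ star-chain (s ∘ suc) (step ∘ suc) i

occurs : (v : Fin n) (xs : Vec (Fin n) m) {k : ℕ} → count (v ==_) (toList xs) ≡ suc k → ∃ λ i → Vec.lookup xs i ≡ v
occurs v (x ∷ xs) c with v == x in e
... | true  = zero , sym (==⇒≡ v x e)
... | false = let i , p = occurs v xs c in suc i , p

-- The Euler circuit a, ws of the 4-regular graph with an edge from each letter
-- of the cyclic word to the next one.
module CyclicWord {{nonZero : NonZero n}} (G : SimpleGraph n) (a : Fin n) (ws : Vec (Fin n) m)
                  (r : Realises (a ∷ toList ws) G) where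

  start finish : Fin (suc m) → Fin n
  start  = Vec.lookup (a ∷ ws)
  finish = Vec.lookup (ws Vec.∷ʳ a)

  F : MultiGraph
  F = record
    { order    = n
    ; size     = suc m
    ; nonempty = nonZero
    ; end      = λ e b → if b then finish e else start e
    }

  open MultiGraph F hiding (nonempty)

  next : ∀ i → finish (inject₁ i) ≡ start (suc i)
  next = lookup-∷ʳ-inject₁ ws a

  reach : ∀ i → Connected a (start i)
  reach = star-chain start λ i → (inject₁ i , false) , refl , next i

  -- Every letter occurs in the word, so the traced graph is connected even where `G` is not, and
  -- one circuit forms an Euler system.
  connected : ∀ u v → Connected u v
  connected u v with occurs u (a ∷ ws) (twice r u) | occurs v (a ∷ ws) (twice r v)
  ... | i , refl | j , refl = connected-sym F (reach i) ◅◅ reach j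

  starts : map (λ e → end e false) (allFin size) ≡ a ∷ toList ws
  starts = trans (map-tabulate id start) (tabulate-lookup-toList (a ∷ ws))

  finishes : map (λ e → end e true) (allFin size) ≡ toList ws ∷ʳ a
  finishes = trans (map-tabulate id finish) (trans (tabulate-lookup-toList (ws Vec.∷ʳ a)) (toList-∷ʳ a ws))

  regular : FourRegular
  regular v = begin
    valency v
      ≡⟨ valency-ends F v (allFin size) ⟩
    count (v ==_) (map (λ e → end e false) (allFin size)) + count (v ==_) (map (λ e → end e true) (allFin size))
      ≡⟨ cong₂ (λ xs ys → count (v ==_) xs + count (v ==_) ys) starts finishes ⟩
    count (v ==_) (a ∷ toList ws) + count (v ==_) (toList ws ∷ʳ a)
      ≡⟨ cong₂ _+_ (twice r v) (trans (count-++ (v ==_) (toList ws) (a ∷ []))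
           (trans (+-comm (count (v ==_) (toList ws)) _)
             (trans (sym (count-++ (v ==_) (a ∷ []) (toList ws))) (twice r v)))) ⟩
    4 ∎
    where open ≡-Reasoning

  forward : Edge → HalfEdge
  forward e = e , false

  circuit : List HalfEdge
  circuit = List.tabulate forward

  circuit-edges : map edge circuit ≡ allFin size
  circuit-edges = map-tabulate forward edge

  circuit-sources : map source circuit ≡ a ∷ toList ws
  circuit-sources = trans (map-tabulate forward source) (tabulate-lookup-toList (a ∷ ws))

  euler : ∀ v → IsEulerCircuitAt v circuit
  euler v = record
    { closed       = tabulate-linked forward next (lookup-∷ʳ-fromℕ ws a)
    ; edges-unique = subst Unique (sym circuit-edges) (allFin⁺ size)
    ; edges-cover  = λ e → mk⇔ (λ _ → connected v _) (λ _ → subst (e Mem.∈_) (sym circuit-edges) (∈-allFin e))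
    }

  C : EulerSystem
  C = record
    { circuits          = circuit ∷ []
    ; eulerian          = (a , euler a) ∷ []
    ; one-per-component = λ v → zero , euler v , λ { {zero} _ → refl }
    }

  interlacement : ∀ u v → adj G u v ≡ adj (𝓘 C) u v
  interlacement u v = cases (u ≟ v)
    where
    cases : Dec (u ≡ v) → adj G u v ≡ adj (𝓘 C) u v
    cases (yes refl) = trans (adj-irrefl G u) (sym (adj-irrefl (𝓘 C) u))
    cases (no u≢v)   = trans (crossing r u v u≢v)
      (≡does (pairs (u ==_) (v ==_) (a ∷ toList ws)) (interlaced? C u v) (mk⇔
        (λ { (_ , here alt) → Equivalence.to alternating⇔ (subst (Alternating u v) circuit-sources alt)
           ; (_ , there ()) })
        (λ p → u≢v , here (subst (Alternating u v) (sym circuit-sources) (Equivalence.from alternating⇔ p)))))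
      where
      alternating⇔ : Alternating u v (a ∷ toList ws) ⇔ (pairs (u ==_) (v ==_) (a ∷ toList ws) ≡ true)
      alternating⇔ = alternating⇔pairs u≢v (a ∷ toList ws) (twice r u) (twice r v)

  circle : CircleGraph G
  circle = F , regular , C , ↔-id _ , interlacement

realisable⇒circle : .{{_ : NonZero n}} {G : SimpleGraph n} → Realisable G → CircleGraph G
realisable⇒circle {n = suc n} {G} ([] , r) with () ← twice r zero
realisable⇒circle {n = suc n} {G} (a ∷ w , r) =
  CyclicWord.circle G a (fromList w) (subst (λ w → Realises (a ∷ w) G) (sym (toList∘fromList w)) r)

-- Short closed trails in words over at most six letters

≡ᵇ-refl : ∀ k → (k ≡ᵇ k) ≡ true
≡ᵇ-refl k = Equivalence.to T-≡ (≡⇒≡ᵇ k k refl)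

≢⇒≡ᵇ : ∀ {k l} → k ≢ l → (k ≡ᵇ l) ≡ false
≢⇒≡ᵇ {k} {l} k≢l = Bool.¬-not λ e → k≢l (≡ᵇ⇒≡ k l (Equivalence.from T-≡ e))

parity-false : (f : X → Bool) → ∀ w → All (λ a → f a ≡ false) w → parity f w ≡ false
parity-false f []      []       = refl
parity-false f (a ∷ w) (p ∷ ps) = cong₂ _xor_ p (parity-false f w ps)

-- Positions are plain numbers, with `nothing` beyond the end, so that shifted positions such as
-- `3 + p` carry no bounds in their types.
at : List X → ℕ → Maybe X
at []      k       = nothing
at (a ∷ w) zero    = just a
at (a ∷ w) (suc k) = at w k

at-≤ : (w : List X) {j k : ℕ} {a : X} → j ≤ k → at w k ≡ just a → ∃ λ b → at w j ≡ just b
at-≤ (b ∷ w) z≤n     e = b , refl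
at-≤ (b ∷ w) (s≤s p) e = at-≤ w p e

at-< : (w : List X) {k : ℕ} → k < length w → ∃ λ a → at w k ≡ just a
at-< (a ∷ w) {zero}  p       = a , refl
at-< (a ∷ w) {suc k} (s≤s p) = at-< w p

at-++ : (α : List X) {a : X} {β : List X} → at (α ++ a ∷ β) (length α) ≡ just a
at-++ []      = refl
at-++ (_ ∷ α) = at-++ α

positions : (X → Bool) → List X → List ℕ
positions f []      = []
positions f (a ∷ w) with f a
... | true  = 0 ∷ map suc (positions f w)
... | false = map suc (positions f w)

length-positions : (f : X → Bool) → ∀ w → length (positions f w) ≡ count f w
length-positions f []      = refl
length-positions f (a ∷ w) with f a
... | true  = cong suc (trans (length-map suc (positions f w)) (length-positions f w))
... | false = trans (length-map suc (positions f w)) (length-positions f w)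

∈-positions⁺ : (f : X → Bool) → ∀ w {k a} → at w k ≡ just a → f a ≡ true → k Mem.∈ positions f w
∈-positions⁺ f (a ∷ w) {zero}  refl fa rewrite fa = here refl
∈-positions⁺ f (a ∷ w) {suc k} e    fb with f a
... | true  = there (∈-map⁺ suc (∈-positions⁺ f w e fb))
... | false = ∈-map⁺ suc (∈-positions⁺ f w e fb)

∈-positions⁻ : (f : X → Bool) → ∀ w {k} → k Mem.∈ positions f w → ∃ λ a → at w k ≡ just a × f a ≡ true
∈-positions⁻ f (a ∷ w) k∈ with f a in fa
∈-positions⁻ f (a ∷ w) (here refl) | true = a , refl , fa
∈-positions⁻ f (a ∷ w) (there k∈)  | true with ∈-map⁻ suc k∈
... | k , k∈′ , refl = ∈-positions⁻ f w k∈′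
∈-positions⁻ f (a ∷ w) k∈          | false with ∈-map⁻ suc k∈
... | k , k∈′ , refl = ∈-positions⁻ f w k∈′

positions-! : (f : X → Bool) → ∀ w → Unique (positions f w)
positions-! f []      = []
positions-! f (a ∷ w) with f a
... | true  = All.tabulate (λ k∈ → λ { refl → 0∉ k∈ }) ∷ Unique.map⁺ suc-injective (positions-! f w)
  where
  0∉ : ¬ (0 Mem.∈ map suc (positions f w))
  0∉ k∈ with ∈-map⁻ suc k∈
  ... | _ , _ , ()
... | false = Unique.map⁺ suc-injective (positions-! f w)

count-exclusive : {f g : X → Bool} → Exclusive f g → ∀ w → count f w + count g w ≤ length w
count-exclusive ex []      = z≤n
count-exclusive {f = f} {g} ex (a ∷ w) with f a | g a | ex a
... | true  | false | _ = s≤s (count-exclusive ex w)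
... | false | true  | _ = ≤-trans (≤-reflexive (+-suc (count f w) (count g w))) (s≤s (count-exclusive ex w))
... | false | false | _ = m≤n⇒m≤1+n (count-exclusive ex w)

-- No order between `first` and `second` is recorded, only that they differ.
record Occurrences (w : List (Fin n)) (v : Fin n) : Set where
  field
    first second : ℕ
    first≢second : first ≢ second
    at-first     : at w first ≡ just v
    at-second    : at w second ≡ just v
    only         : ∀ {k} → at w k ≡ just v → k ≡ first ⊎ k ≡ second

occurrences : (w : List (Fin n)) (v : Fin n) → count (v ==_) w ≡ 2 → Occurrences w v
occurrences w v c with positions (v ==_) w | trans (length-positions (v ==_) w) c
  | positions-! (v ==_) w | ∈-positions⁺ (v ==_) w | ∈-positions⁻ (v ==_) w
... | i ∷ j ∷ [] | _ | (i≢j ∷ []) ∷ _ | complete | sound = record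
  { first        = i
  ; second       = j
  ; first≢second = i≢j
  ; at-first     = at-v (here refl)
  ; at-second    = at-v (there (here refl))
  ; only         = λ e → which (complete e (==-refl v))
  }
  where
  at-v : ∀ {k} → k Mem.∈ i ∷ j ∷ [] → at w k ≡ just v
  at-v k∈ with sound k∈
  ... | a , e , va rewrite ==⇒≡ v a va = e

  which : ∀ {k} → k Mem.∈ i ∷ j ∷ [] → k ≡ i ⊎ k ≡ j
  which (here p)         = inj₁ p
  which (there (here p)) = inj₂ p

sum-parity : (x : Fin n → Bool) (β : List (Fin n)) → sum (λ u → parity (u ==_) β ∧ x u) ≡ parity x β
sum-parity x []      = sum-false (λ u → parity (u ==_) [] ∧ x u) λ _ → refl
sum-parity x (b ∷ β) = begin
  sum (λ u → ((u == b) xor parity (u ==_) β) ∧ x u)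
    ≡⟨ sum-cong-≗ (λ u → trans (∧-distribʳ-xor (x u) (u == b) _)
         (cong (λ e → (e ∧ x u) xor (parity (u ==_) β ∧ x u)) (==-sym u b))) ⟩
  sum (λ u → ((b == u) ∧ x u) xor (parity (u ==_) β ∧ x u))
    ≡⟨ ∑-distrib-+ (λ u → (b == u) ∧ x u) (λ u → parity (u ==_) β ∧ x u) ⟩
  sum (λ u → (b == u) ∧ x u) xor sum (λ u → parity (u ==_) β ∧ x u)
    ≡⟨ cong₂ _xor_ (sum-single b x) (sum-parity x β) ⟩
  parity x (b ∷ β) ∎
  where open ≡-Reasoning

module _ {G : SimpleGraph n} {w : List (Fin n)} (r : Realises w G) where

  -- By `parity-between`, the product at `v` is the parity of `x` strictly between the two
  -- occurrences of `v`. As `x v` is zero, this is the difference of the prefix parities before the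
  -- two occurrences.
  prefix-parity⇒product : (x : Fin n → Bool) (v : Fin n) → x v ≡ false →
    (∀ α β → w ≡ α ++ v ∷ β → parity x α ≡ false) → (G · x) v ≡ false
  prefix-parity⇒product x v xv balanced with split (v ==_) w (twice r v)
  ... | α , a , β′ , w≡ , va , α₀ , c₁ with split (v ==_) β′ c₁
  ...   | β , b , γ , refl , vb , β₀ , γ₀ with refl ← ==⇒≡ v a va | refl ← ==⇒≡ v b vb = begin
    (G · x) v
      ≡⟨ sum-cong-≗ (λ u → cong (_∧ x u) (sym
           (parity-between v α β γ (subst (λ w → Realises w G) w≡ r) α₀ β₀ γ₀ u))) ⟩
    sum (λ u → parity (u ==_) β ∧ x u)
      ≡⟨ sum-parity x β ⟩
    parity x β
      ≡⟨ cong (_xor parity x β) (sym (cong₂ _xor_ (balanced α _ w≡) xv)) ⟩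
    (parity x α xor x v) xor parity x β
      ≡⟨ solve 3 (λ a b c → (a :+ b) :+ c := a :+ (b :+ c)) refl (parity x α) (x v) (parity x β) ⟩
    parity x α xor parity x (v ∷ β)
      ≡⟨ sym (parity-++ x α (v ∷ β)) ⟩
    parity x (α ++ v ∷ β)
      ≡⟨ balanced (α ++ v ∷ β) γ (trans w≡ (sym (++-assoc α (v ∷ β) (v ∷ γ)))) ⟩
    false ∎
    where open ≡-Reasoning

-- Edge e of the graph traced by the word w joins the letters at positions e
-- and e + 1.
module Trails (w : List (Fin n)) where

  -- An edge may be traversed in either direction. The edge that closes the word cyclically is left
  -- out, so no edge ends at position 0.
  Step : Fin n → Fin n → ℕ → Set
  Step a b e = (at w e ≡ just a × at w (suc e) ≡ just b) ⊎ (at w e ≡ just b × at w (suc e) ≡ just a)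

  step-sym : ∀ {a b e} → Step a b e → Step b a e
  step-sym (inj₁ p) = inj₂ p
  step-sym (inj₂ p) = inj₁ p

  infixr 5 _∷_

  data Trail : Fin n → Fin n → List ℕ → Set where
    []  : ∀ {a} → Trail a a []
    _∷_ : ∀ {a b z e es} → Step a b e → Trail b z es → Trail a z (e ∷ es)

  -- The final vertex is omitted: in a closed trail it is the first corner, and so there are as many
  -- corners as edges.
  corners : ∀ {a z es} → Trail a z es → List (Fin n)
  corners []              = []
  corners {a} (step ∷ t)  = a ∷ corners t

  length-corners : ∀ {a z es} (t : Trail a z es) → length (corners t) ≡ length es
  length-corners []         = refl
  length-corners (step ∷ t) = cong suc (length-corners t)

  -- gap es k tells whether the edge ending at position k is among es
  gap : List ℕ → ℕ → Bool
  gap es k = parity (λ e → k ≡ᵇ suc e) es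

  -- Modulo two, the number of edges of `es` that touch position `k`, since edge k - 1 ends there
  -- and edge k starts there.
  jump : List ℕ → ℕ → Bool
  jump es k = gap es k xor gap es (suc k)

  step-avoids : ∀ {a b e k v} → Step a b e → v ≢ a → v ≢ b → at w k ≡ just v → k ≢ e × k ≢ suc e
  step-avoids (inj₁ (p , q)) v≢a v≢b at-k =
    (λ { refl → v≢a (just-injective (trans (sym at-k) p)) }) ,
    (λ { refl → v≢b (just-injective (trans (sym at-k) q)) })
  step-avoids (inj₂ (p , q)) v≢a v≢b at-k =
    (λ { refl → v≢b (just-injective (trans (sym at-k) p)) }) ,
    (λ { refl → v≢a (just-injective (trans (sym at-k) q)) })

  trail-avoids : ∀ {a z es k v} (t : Trail a z es) → ¬ (v Mem.∈ corners t) → v ≢ z → at w k ≡ just v →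
    All (λ e → k ≢ e × k ≢ suc e) es
  trail-avoids []                 v∉ v≢z at-k = []
  trail-avoids (step ∷ [])        v∉ v≢z at-k = step-avoids step (λ v≡a → v∉ (here v≡a)) v≢z at-k ∷ []
  trail-avoids (step ∷ t@(_ ∷ _)) v∉ v≢z at-k =
    step-avoids step (λ v≡a → v∉ (here v≡a)) (λ v≡b → v∉ (there (here v≡b))) at-k ∷
    trail-avoids t (v∉ ∘ there) v≢z at-k

  module _ (two : ∀ v → count (v ==_) w ≡ 2) where

    module O v = Occurrences (occurrences w v (two v))

    hits : ∀ v {k a} → at w k ≡ just a → (O.first v ≡ᵇ k) xor (O.second v ≡ᵇ k) ≡ (v == a)
    hits v {k} {a} at-k with v Fin.≟ a
    ... | no v≢a = trans (cong₂ _xor_ (≢⇒≡ᵇ (miss (O.at-first v))) (≢⇒≡ᵇ (miss (O.at-second v)))) (sym (≢⇒== v≢a))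
      where
      miss : ∀ {i} → at w i ≡ just v → i ≢ k
      miss at-i refl = v≢a (just-injective (trans (sym at-i) at-k))
    ... | yes refl with O.only v at-k
    ...   | inj₁ refl = trans (cong₂ _xor_ (≡ᵇ-refl k) (≢⇒≡ᵇ (O.first≢second v ∘ sym))) (sym (==-refl v))
    ...   | inj₂ refl = trans (cong₂ _xor_ (≢⇒≡ᵇ (O.first≢second v)) (≡ᵇ-refl k)) (sym (==-refl v))

    step-hits : ∀ v {a b e} → Step a b e →
      ((O.first v ≡ᵇ suc e) xor (O.first v ≡ᵇ e)) xor ((O.second v ≡ᵇ suc e) xor (O.second v ≡ᵇ e)) ≡
      (v == a) xor (v == b)
    step-hits v {a} {b} {e} step = trans
      (solve 4 (λ p q r s → (p :+ q) :+ (r :+ s) := (q :+ s) :+ (p :+ r)) refl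
        (O.first v ≡ᵇ suc e) (O.first v ≡ᵇ e) (O.second v ≡ᵇ suc e) (O.second v ≡ᵇ e))
      (ends step)
      where
      ends : Step a b e →
        ((O.first v ≡ᵇ e) xor (O.second v ≡ᵇ e)) xor ((O.first v ≡ᵇ suc e) xor (O.second v ≡ᵇ suc e)) ≡ (v == a) xor (v == b)
      ends (inj₁ (p , q)) = cong₂ _xor_ (hits v p) (hits v q)
      ends (inj₂ (p , q)) = trans (cong₂ _xor_ (hits v p) (hits v q)) (Bool.xor-comm (v == b) (v == a))

    -- Both sides are the parity of the degree of `v` in the trail: at interior visits the trail
    -- enters and leaves, so only its two ends contribute.
    telescope : ∀ v {a z es} → Trail a z es → jump es (O.first v) xor jump es (O.second v) ≡ (v == a) xor (v == z)
    telescope v {a} [] = sym (Bool.xor-same (v == a))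
    telescope v {a} {z} (_∷_ {b = b} {e = e} {es = es} step t) = begin
      ((p xor P) xor (q xor Q)) xor ((r xor R) xor (s xor S))
        ≡⟨ solve 8 (λ p P q Q r R s S → ((p :+ P) :+ (q :+ Q)) :+ ((r :+ R) :+ (s :+ S))
             := ((p :+ q) :+ (r :+ s)) :+ ((P :+ Q) :+ (R :+ S))) refl p P q Q r R s S ⟩
      ((p xor q) xor (r xor s)) xor (jump es (O.first v) xor jump es (O.second v))
        ≡⟨ cong₂ _xor_ (step-hits v step) (telescope v t) ⟩
      ((v == a) xor (v == b)) xor ((v == b) xor (v == z))
        ≡⟨ solve 3 (λ a b z → (a :+ b) :+ (b :+ z) := a :+ z) refl (v == a) (v == b) (v == z) ⟩
      (v == a) xor (v == z) ∎
      where
      open ≡-Reasoning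
      p = O.first v ≡ᵇ suc e
      q = O.first v ≡ᵇ e
      r = O.second v ≡ᵇ suc e
      s = O.second v ≡ᵇ e
      P = gap es (O.first v)
      Q = gap es (suc (O.first v))
      R = gap es (O.second v)
      S = gap es (suc (O.second v))

    module _ {a e es} (t : Trail a a (e ∷ es)) (e∉es : All (e ≢_) es) where

      private
        D = e ∷ es

      jumps : Fin n → Bool
      jumps v = jump D (O.first v)

      -- In a closed trail the two ends cancel in `telescope`, so either occurrence of `v` gives the
      -- same value.
      jumps-at : ∀ {k v} → at w k ≡ just v → jumps v ≡ jump D k
      jumps-at {k} {v} at-k with O.only v at-k
      ... | inj₁ refl = refl
      ... | inj₂ refl = xor≡false (trans (telescope v t) (Bool.xor-same (v == a)))
        where
        xor≡false : ∀ {b c} → b xor c ≡ false → b ≡ c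
        xor≡false {true}  {true}  _ = refl
        xor≡false {false} {false} _ = refl

      -- The sum of the jumps telescopes to the difference of the gaps at its two ends, and the gap
      -- at position 0 is false.
      prefix-jumps : ∀ α {β} → w ≡ α ++ β → parity jumps α ≡ gap D (length α)
      prefix-jumps α {β} w≡ = trans (go 0 α (λ k → cong (λ w → at w k) w≡))
        (cong (_xor gap D (length α)) (parity-false _ D (All.tabulate λ _ → refl)))
        where
        go : ∀ k xs → (∀ j → at w (k + j) ≡ at (xs ++ β) j) → parity jumps xs ≡ gap D k xor gap D (k + length xs)
        go k []       same = sym (trans (cong (λ l → gap D k xor gap D l) (+-identityʳ k))
          (Bool.xor-same (gap D k)))
        go k (x ∷ xs) same = begin
          jumps x xor parity jumps xs
            ≡⟨ cong₂ _xor_ (jumps-at (trans (cong (at w) (sym (+-identityʳ k))) (same 0)))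
                 (go (suc k) xs (λ j → trans (cong (at w) (sym (+-suc k j))) (same (suc j)))) ⟩
          (gap D k xor gap D (suc k)) xor (gap D (suc k) xor gap D (suc k + length xs))
            ≡⟨ solve 3 (λ a b c → (a :+ b) :+ (b :+ c) := a :+ c) refl
                 (gap D k) (gap D (suc k)) (gap D (suc k + length xs)) ⟩
          gap D k xor gap D (suc k + length xs)
            ≡⟨ cong (λ l → gap D k xor gap D l) (sym (+-suc k (length xs))) ⟩
          gap D k xor gap D (k + length (x ∷ xs)) ∎
          where open ≡-Reasoning

      some-jump : ∀ k → gap D (suc k) ≡ true → ∃ λ j → j ≤ k × jump D j ≡ true
      some-jump zero    g = 0 , z≤n , cong₂ _xor_ (parity-false _ D (All.tabulate λ _ → refl)) g
      some-jump (suc k) g with gap D (suc k) in g′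
      ... | true  = let j , j≤k , J = some-jump k g′ in j , m≤n⇒m≤1+n j≤k , J
      ... | false = suc k , ≤-refl , cong₂ _xor_ g′ g

      -- As `e` is not repeated, the gap at `suc e` is true, whereas the gap at position 0 is false;
      -- hence it changes at some position up to `e`, and such a position carries a letter.
      jumps-nonzero : ∃ λ v → jumps v ≡ true
      jumps-nonzero with some-jump e gap-e | step-start t
        where
        gap-e : gap D (suc e) ≡ true
        gap-e = cong₂ _xor_ (≡ᵇ-refl e) (parity-false _ es (All.map ≢⇒≡ᵇ e∉es))
        step-start : ∀ {b c f fs} → Trail b c (f ∷ fs) → ∃ λ v → at w f ≡ just v
        step-start (inj₁ (p , _) ∷ _) = _ , p
        step-start (inj₂ (p , _) ∷ _) = _ , p
      ... | j , j≤e , J | _ , at-e with at-≤ w j≤e at-e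
      ...   | v , at-j = v , trans (jumps-at at-j) J

      corner-set : Subset n
      corner-set = foldr (λ v S → S [ v ]≔ inside) ∅ (corners t)

      ∣corner-set∣ : ∣ corner-set ∣ ≤ length D
      ∣corner-set∣ = ≤-trans (go (corners t)) (≤-reflexive (length-corners t))
        where
        go : ∀ us → ∣ foldr (λ v S → S [ v ]≔ inside) ∅ us ∣ ≤ length us
        go []       = ≤-reflexive (∣⊥∣≡0 n)
        go (u ∷ us) = ≤-trans ([]≔-∣∣ (foldr (λ v S → S [ v ]≔ inside) ∅ us) u) (s≤s (go us))

      ∉-corner-set : ∀ {v} → v ∉ corner-set → ¬ (v Mem.∈ corners t)
      ∉-corner-set v∉ v∈ = v∉ (go (corners t) v∈)
        where
        go : ∀ us {v} → v Mem.∈ us → v ∈ foldr (λ v S → S [ v ]≔ inside) ∅ us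
        go (u ∷ us) (here refl) = ∈-[]≔ _ u
        go (u ∷ us) (there v∈)  = ∈-[]≔⁺ _ u (go us v∈)

      gap-out : ∀ {v k} → v ∉ corner-set → at w k ≡ just v → gap D k ≡ false × gap D (suc k) ≡ false
      gap-out {v} {k} v∉ at-k =
          parity-false _ D (All.map (λ (_ , k≢) → ≢⇒≡ᵇ k≢) avoided) ,
          parity-false _ D (All.map (λ (k≢ , _) → ≢⇒≡ᵇ k≢) avoided)
        where
        avoided : All (λ e → k ≢ e × k ≢ suc e) D
        avoided = trail-avoids t (∉-corner-set v∉) (λ { refl → ∉-corner-set v∉ (start-corner t) }) at-k
          where
          start-corner : ∀ {b c f fs} (t : Trail b c (f ∷ fs)) → b Mem.∈ corners t
          start-corner (_ ∷ _) = here refl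

      -- At both occurrences of a letter off the corners, the gaps on either side are false. Their
      -- sum is the jump, and by `prefix-jumps` the left gaps are the prefix parities that determine
      -- the product.
      trail-confined : {G : SimpleGraph n} → Realises w G → Confined G corner-set
      trail-confined r = record
        { vec      = jumps
        ; nonzero  = jumps-nonzero
        ; vec-out  = out
        ; prod-out = λ {v} v∉ → prefix-parity⇒product r jumps v (out v∉) λ α β w≡ →
            trans (prefix-jumps α w≡) (proj₁ (gap-out v∉ (trans (cong (λ w → at w (length α)) w≡) (at-++ α))))
        }
        where
        out : ∀ {v} → v ∉ corner-set → jumps v ≡ false
        out {v} v∉ = let p , q = gap-out v∉ (O.at-first v) in cong₂ _xor_ p q

  record ShortCircuit : Set where
    field
      {corner}   : Fin n
      {e}        : ℕ
      {es}       : List ℕ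
      trail      : Trail corner corner (e ∷ es)
      fresh      : All (e ≢_) es
      short      : length es ≤ 2

  circuit : ∀ {a z e es} (t : Trail a z (e ∷ es)) → All (e ≢_) es → length es ≤ 2 → a ≡ z → ShortCircuit
  circuit t fresh short refl = record { trail = t ; fresh = fresh ; short = short }

  -- The tree formed by a vertex u with four neighbours, and two further
  -- neighbours of the first of these, has seven nodes and diameter three.
  module Tree (u : Fin n) (leaf : Fin 4 → Fin n) (far : Fin 2 → Fin n) (edges : Vec ℕ 6)
              (unique : VecUnique.Unique edges)
              (leaf-step : ∀ i → Step u (leaf i) (lookup edges (i ↑ˡ 2)))
              (far-step : ∀ k → Step (leaf 0F) (far k) (lookup edges (4 ↑ʳ k))) where

    distinct : ∀ {i j} → i ≢ j → lookup edges i ≢ lookup edges j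
    distinct {i} {j} i≢j e≡ = i≢j (lookup-injective unique i j e≡)

    near≢ : ∀ {i j : Fin 4} → i ≢ j → i ↑ˡ 2 ≢ j ↑ˡ 2
    near≢ i≢j = i≢j ∘ Fin.↑ˡ-injective 2 _ _

    near≢far : ∀ (i : Fin 4) (k : Fin 2) → i ↑ˡ 2 ≢ 4 ↑ʳ k
    near≢far i k p = contradiction
      (trans (sym (Fin.splitAt-↑ˡ 4 i 2)) (trans (cong (splitAt 4) p) (Fin.splitAt-↑ʳ 4 2 k))) λ ()

    data Node : Set where
      centre  : Node
      leaf-of : Fin 4 → Node
      far-of  : Fin 2 → Node

    letter : Node → Fin n
    letter centre      = u
    letter (leaf-of i) = leaf i
    letter (far-of k)  = far k

    centre-leaf : ∀ i → u ≡ leaf i → ShortCircuit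
    centre-leaf i = circuit (leaf-step i ∷ []) [] z≤n

    centre-far : ∀ k → u ≡ far k → ShortCircuit
    centre-far k = circuit (leaf-step 0F ∷ far-step k ∷ []) (distinct (near≢far 0F k) ∷ []) (s≤s z≤n)

    leaf-leaf : ∀ i j → i ≢ j → leaf i ≡ leaf j → ShortCircuit
    leaf-leaf i j i≢j = circuit (step-sym (leaf-step i) ∷ leaf-step j ∷ []) (distinct (near≢ i≢j) ∷ []) (s≤s z≤n)

    leaf-far : ∀ i k → leaf i ≡ far k → ShortCircuit
    leaf-far zero    k = circuit (far-step k ∷ []) [] z≤n
    -- These are the only pairs of nodes at distance three; all the others need at most two edges.
    leaf-far (suc i) k = circuit (step-sym (leaf-step (suc i)) ∷ leaf-step 0F ∷ far-step k ∷ [])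
      (distinct (near≢ {suc i} {0F} λ ()) ∷ distinct (near≢far (suc i) k) ∷ []) (s≤s (s≤s z≤n))

    far-far : ∀ k l → k ≢ l → far k ≡ far l → ShortCircuit
    far-far k l k≢l = circuit (step-sym (far-step k) ∷ far-step l ∷ [])
      (distinct (k≢l ∘ Fin.↑ʳ-injective 4 _ _) ∷ []) (s≤s z≤n)

    coincidence : ∀ x y → x ≢ y → letter x ≡ letter y → ShortCircuit
    coincidence centre      centre      x≢y p = contradiction refl x≢y
    coincidence centre      (leaf-of i) x≢y p = centre-leaf i p
    coincidence centre      (far-of k)  x≢y p = centre-far k p
    coincidence (leaf-of i) centre      x≢y p = centre-leaf i (sym p)
    coincidence (leaf-of i) (leaf-of j) x≢y p = leaf-leaf i j (x≢y ∘ cong leaf-of) p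
    coincidence (leaf-of i) (far-of k)  x≢y p = leaf-far i k p
    coincidence (far-of k)  centre      x≢y p = centre-far k (sym p)
    coincidence (far-of k)  (leaf-of i) x≢y p = leaf-far i k (sym p)
    coincidence (far-of k)  (far-of l)  x≢y p = far-far k l (x≢y ∘ cong far-of) p

    node : Fin 7 → Node
    node 0F = centre
    node 1F = leaf-of 0F
    node 2F = leaf-of 1F
    node 3F = leaf-of 2F
    node 4F = leaf-of 3F
    node 5F = far-of 0F
    node 6F = far-of 1F

    index : Node → Fin 7
    index centre      = 0F
    index (leaf-of i) = suc (i ↑ˡ 2)
    index (far-of k)  = suc (4 ↑ʳ k)

    index-node : ∀ i → index (node i) ≡ i
    index-node 0F = refl
    index-node 1F = refl
    index-node 2F = refl
    index-node 3F = refl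
    index-node 4F = refl
    index-node 5F = refl
    index-node 6F = refl

    short-circuit : n ≤ 6 → ShortCircuit
    short-circuit n≤6 with Fin.pigeonhole (s≤s n≤6) (letter ∘ node)
    ... | i , j , i<j , p = coincidence (node i) (node j)
      (λ e → Fin.<⇒≢ i<j (trans (sym (index-node i)) (trans (cong index e) (index-node j)))) p

  module _ (two : ∀ v → count (v ==_) w ≡ 2) where

    partner : ∀ {k v} → at w k ≡ just v → ∃ λ l → l ≢ k × at w l ≡ just v
    partner {k} {v} at-k = pick (only at-k)
      where
      open Occurrences (occurrences w v (two v))
      pick : k ≡ first ⊎ k ≡ second → ∃ λ l → l ≢ k × at w l ≡ just v
      pick (inj₁ refl) = second , first≢second ∘ sym , at-second
      pick (inj₂ refl) = first , first≢second , at-first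

    -- Look for the second occurrences p and q of the letters u and v at the
    -- positions 1 and 2.  If one of them is at most 3, or if p and q are
    -- adjacent, then there is a short circuit; otherwise the edges around
    -- u and v form a tree.
    module _ (n≤6 : n ≤ 6) {a u v b : Fin n}
             (at-0 : at w 0 ≡ just a) (at-1 : at w 1 ≡ just u) (at-2 : at w 2 ≡ just v) (at-3 : at w 3 ≡ just b)
      where

      same : ∀ {k x y} → at w k ≡ just x → at w k ≡ just y → x ≡ y
      same p q = just-injective (trans (sym p) q)

      loop : ∀ {e x y} → at w e ≡ just x → at w (suc e) ≡ just y → x ≡ y → ShortCircuit
      loop p q = circuit (inj₁ (p , q) ∷ []) [] z≤n

      digon : ∀ {x y e f} → Step x y e → Step y x f → e ≢ f → ShortCircuit
      digon s t e≢f = circuit (s ∷ t ∷ []) (e≢f ∷ []) (s≤s z≤n) refl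

      -- The tree is centred at the letter whose second occurrence comes earlier, for then the
      -- position after that occurrence surely lies in the word. If the second occurrences are
      -- adjacent, two of the six tree edges would coincide, but the edge between them is then
      -- parallel to edge 1.
      far-apart : ∀ p q → at w (4 + p) ≡ just u → at w (4 + q) ≡ just v → ShortCircuit
      far-apart p q at-p at-q with at-≤ w (n≤1+n _) at-p | at-≤ w (n≤1+n _) at-q | <-cmp p q
      ... | c , at-p⁻ | d , at-q⁻ | tri≈ _ refl _ = loop at-1 at-2 (same at-p at-q)
      ... | c , at-p⁻ | d , at-q⁻ | tri< p<q p≢q _ with suc p ℕ.≟ q
      ...   | yes refl = digon (inj₁ (at-1 , at-2)) (inj₂ (at-p , at-q)) λ ()
      ...   | no 1+p≢q with at-≤ w (s≤s (s≤s (s≤s (s≤s p<q)))) at-q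
      ...     | c′ , at-p⁺ = Tree.short-circuit u
          (lookup (v ∷ a ∷ c ∷ c′ ∷ [])) (lookup (b ∷ d ∷ []))
          (1 ∷ 0 ∷ 3 + p ∷ 4 + p ∷ 2 ∷ 3 + q ∷ [])
          (((λ ()) ∷ (λ ()) ∷ (λ ()) ∷ (λ ()) ∷ (λ ()) ∷ []) ∷
           ((λ ()) ∷ (λ ()) ∷ (λ ()) ∷ (λ ()) ∷ []) ∷
           (1+n≢n ∘ sym ∷ (λ ()) ∷ p≢q ∘ +-cancelˡ-≡ 3 p q ∷ []) ∷
           ((λ ()) ∷ 1+p≢q ∘ +-cancelˡ-≡ 3 (suc p) q ∷ []) ∷
           ((λ ()) ∷ []) ∷ [] ∷ [])
          (λ { 0F → inj₁ (at-1 , at-2) ; 1F → inj₂ (at-0 , at-1)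
             ; 2F → inj₂ (at-p⁻ , at-p) ; 3F → inj₁ (at-p , at-p⁺) })
          (λ { 0F → inj₁ (at-2 , at-3) ; 1F → inj₂ (at-q⁻ , at-q) })
          n≤6
      far-apart p q at-p at-q | c , at-p⁻ | d , at-q⁻ | tri> _ p≢q q<p with suc q ℕ.≟ p
      ...   | yes refl = digon (inj₁ (at-1 , at-2)) (inj₁ (at-q , at-p)) λ ()
      ...   | no 1+q≢p with at-≤ w (s≤s (s≤s (s≤s (s≤s q<p)))) at-p
      ...     | d′ , at-q⁺ = Tree.short-circuit v
          (lookup (u ∷ b ∷ d ∷ d′ ∷ [])) (lookup (a ∷ c ∷ []))
          (1 ∷ 2 ∷ 3 + q ∷ 4 + q ∷ 0 ∷ 3 + p ∷ [])
          (((λ ()) ∷ (λ ()) ∷ (λ ()) ∷ (λ ()) ∷ (λ ()) ∷ []) ∷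
           ((λ ()) ∷ (λ ()) ∷ (λ ()) ∷ (λ ()) ∷ []) ∷
           (1+n≢n ∘ sym ∷ (λ ()) ∷ p≢q ∘ sym ∘ +-cancelˡ-≡ 3 q p ∷ []) ∷
           ((λ ()) ∷ 1+q≢p ∘ +-cancelˡ-≡ 3 (suc q) p ∷ []) ∷
           ((λ ()) ∷ []) ∷ [] ∷ [])
          (λ { 0F → inj₂ (at-1 , at-2) ; 1F → inj₁ (at-2 , at-3)
             ; 2F → inj₂ (at-q⁻ , at-q) ; 3F → inj₁ (at-q , at-q⁺) })
          (λ { 0F → inj₂ (at-0 , at-1) ; 1F → inj₂ (at-p⁻ , at-p) })
          n≤6

      short-circuit : ShortCircuit
      short-circuit with partner at-1 | partner at-2
      ... | 0 , _ , at-p   | _ = loop at-0 at-1 (same at-0 at-p)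
      ... | 1 , p≢1 , _    | _ = contradiction refl p≢1
      ... | 2 , _ , at-p   | _ = loop at-1 at-2 (same at-p at-2)
      ... | 3 , _ , at-p   | _ = digon (inj₁ (at-1 , at-2)) (inj₁ (at-2 , at-p)) λ ()
      ... | _ | 0 , _ , at-q = digon (inj₁ (at-q , at-1)) (inj₁ (at-1 , at-2)) λ ()
      ... | _ | 1 , _ , at-q = loop at-1 at-2 (same at-1 at-q)
      ... | _ | 2 , q≢2 , _  = contradiction refl q≢2
      ... | _ | 3 , _ , at-q = loop at-2 at-3 (same at-q at-3)
      ... | suc (suc (suc (suc p))) , _ , at-p | suc (suc (suc (suc q))) , _ , at-q = far-apart p q at-p at-q

-- The trail is sought around the first four positions, which exist as soon as there are two
-- letters; a single vertex is confined by its closed neighbourhood.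
realisable⇒confined : .{{_ : NonZero n}} {G : SimpleGraph n} → n ≤ 6 → Realisable G →
  ∃ λ S → Confined G S × ∣ S ∣ ≤ 3
realisable⇒confined {n = suc zero} {G} _ _ =
  closedNeighbourhood G 0F , confined-neighbourhood G 0F , ≤-trans (∣p∣≤n (closedNeighbourhood G 0F)) (s≤s z≤n)
realisable⇒confined {n = n@(suc (suc _))} {G} n≤6 (w , r)
  with at-< w (≤-trans (s≤s z≤n) 4≤) | at-< w (≤-trans (s≤s (s≤s z≤n)) 4≤)
     | at-< w (≤-trans (s≤s (s≤s (s≤s z≤n))) 4≤) | at-< w 4≤
  where
  4≤ : 4 ≤ length w
  4≤ = ≤-trans (≤-reflexive (sym (cong₂ _+_ (twice r 0F) (twice r 1F))))
    (count-exclusive (==-exclusive {u = 0F} {1F} λ ()) w)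
... | _ , at-0 | _ , at-1 | _ , at-2 | _ , at-3 =
  corner-set two trail fresh , trail-confined two trail fresh r ,
  ≤-trans (∣corner-set∣ two trail fresh) (s≤s short)
  where
  open Trails w
  two = twice r
  open ShortCircuit (short-circuit two n≤6 at-0 at-1 at-2 at-3)

-- Words for graphs with at most five vertices, and for degree at most two

module _ (h : A → B) where

  count-map : ∀ f w → count f (map h w) ≡ count (f ∘ h) w
  count-map f []      = refl
  count-map f (a ∷ w) = cong (λ k → if f (h a) then suc k else k) (count-map f w)

  parity-map : ∀ f w → parity f (map h w) ≡ parity (f ∘ h) w
  parity-map f []      = refl
  parity-map f (a ∷ w) = cong (f (h a) xor_) (parity-map f w)

  pairs-map : ∀ f g w → pairs f g (map h w) ≡ pairs (f ∘ h) (g ∘ h) w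
  pairs-map f g []      = refl
  pairs-map f g (a ∷ w) = cong₂ (λ x y → (f (h a) ∧ x) xor y) (parity-map g w) (pairs-map f g w)

-- Exhaustive search over the graphs with five vertices

all : (Fin n → Bool) → Bool
all {zero}  P = true
all {suc n} P = P zero ∧ all (P ∘ suc)

all-sound : (P : Fin n → Bool) → all P ≡ true → ∀ i → P i ≡ true
all-sound P p zero    = ∧-conicalˡ _ _ p
all-sound P p (suc i) = all-sound (P ∘ suc) (∧-conicalʳ (P zero) _ p) i

agree : Bool → Bool → Bool
agree true  b = b
agree false b = not b

agree-sound : ∀ a b → agree a b ≡ true → a ≡ b
agree-sound true  true  _ = refl
agree-sound false false _ = refl

-- The strict upper triangle of an adjacency matrix, as plain data: symmetry and irreflexivity are
-- built in, so an enumeration meets every graph exactly once.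
Triangular : ℕ → Set
Triangular zero    = ⊤
Triangular (suc n) = Vec Bool n × Triangular n

entry : Triangular n → Fin n → Fin n → Bool
entry {suc n} (r , t) zero    zero    = false
entry {suc n} (r , t) zero    (suc j) = lookup r j
entry {suc n} (r , t) (suc i) zero    = lookup r i
entry {suc n} (r , t) (suc i) (suc j) = entry t i j

pullback : SimpleGraph m → (Fin n → Fin m) → SimpleGraph n
pullback G f = record
  { adj        = λ u v → adj G (f u) (f v)
  ; adj-sym    = λ u v → adj-sym G (f u) (f v)
  ; adj-irrefl = λ v → adj-irrefl G (f v)
  }

triangle : SimpleGraph n → Triangular n
triangle {zero}  G = tt
triangle {suc n} G = tabulate (adj G zero ∘ suc) , triangle (pullback G suc)

entry-triangle : (G : SimpleGraph n) → ∀ u v → entry (triangle G) u v ≡ adj G u v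
entry-triangle G zero    zero    = sym (adj-irrefl G zero)
entry-triangle G zero    (suc v) = lookup∘tabulate _ v
entry-triangle G (suc u) zero    = trans (lookup∘tabulate _ u) (adj-sym G zero (suc u))
entry-triangle G (suc u) (suc v) = entry-triangle (pullback G suc) u v

allVec : (Vec Bool n → Bool) → Bool
allVec {zero}  P = P []
allVec {suc n} P = allVec (P ∘ (false ∷_)) ∧ allVec (P ∘ (true ∷_))

allVec-sound : (P : Vec Bool n → Bool) → allVec P ≡ true → ∀ r → P r ≡ true
allVec-sound P p []          = p
allVec-sound P p (false ∷ r) = allVec-sound (P ∘ (false ∷_)) (∧-conicalˡ _ _ p) r
allVec-sound P p (true ∷ r)  =
  allVec-sound (P ∘ (true ∷_)) (∧-conicalʳ (allVec (P ∘ (false ∷_))) _ p) r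

allTriangular : (Triangular n → Bool) → Bool
allTriangular {zero}  P = P tt
allTriangular {suc n} P = allVec λ r → allTriangular λ t → P (r , t)

allTriangular-sound : (P : Triangular n → Bool) → allTriangular P ≡ true → ∀ t → P t ≡ true
allTriangular-sound {zero}  P p tt      = p
allTriangular-sound {suc n} P p (r , t) =
  allTriangular-sound (λ t → P (r , t)) (allVec-sound _ p r) t

-- Depth-first search for a double occurrence word with the crossings K that has
-- a given beginning; both the beginning and its extension w are kept reversed.
-- Appending the second t settles the crossings of t, so the branch is dropped
-- unless they are right.
module Search (K : Fin n → Fin n → Bool) (beginning : List (Fin n)) where

  since : Fin n → List (Fin n) → List (Fin n)
  since t []      = []
  since t (a ∷ w) = if t == a then [] else a ∷ since t w

  admissible : ℕ → Fin n → List (Fin n) → Bool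
  admissible 0             t w = true
  admissible 1             t w = all λ u → agree (K t u) (parity (u ==_) (since t w))
  admissible (suc (suc _)) t w = false

  mutual
    search : ℕ → List (Fin n) → Maybe (List (Fin n))
    search zero    w = just w
    search (suc k) w = try k (allFin n) w (w ++ beginning)

    try : ℕ → List (Fin n) → List (Fin n) → List (Fin n) → Maybe (List (Fin n))
    try k []       w w′ = nothing
    try k (t ∷ ts) w w′ = branch (admissible (count (t ==_) w′) t w′) k t ts w w′

    branch : Bool → ℕ → Fin n → List (Fin n) → List (Fin n) → List (Fin n) → Maybe (List (Fin n))
    branch false k t ts w w′ = try k ts w w′
    branch true  k t ts w w′ = orElse (search k (t ∷ w)) k ts w w′

    orElse : Maybe (List (Fin n)) → ℕ → List (Fin n) → List (Fin n) → List (Fin n) → Maybe (List (Fin n))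
    orElse (just x) k ts w w′ = just x
    orElse nothing  k ts w w′ = try k ts w w′

-- The search carries no correctness proof; the word that it returns is verified here from the
-- definition of `Realises`.
check : (Fin n → Fin n → Bool) → List (Fin n) → Bool
check K w = all λ u → (count (u ==_) w ≡ᵇ 2) ∧
                      all λ v → if u == v then true else agree (K u v) (pairs (u ==_) (v ==_) w)

check-sound : (G : SimpleGraph n) (K : Fin n → Fin n → Bool) → (∀ u v → K u v ≡ adj G u v) →
  ∀ w → check K w ≡ true → Realises w G
check-sound G K K≡ w p = record
  { twice    = λ u → ≡ᵇ⇒≡ _ 2 (subst T (sym (∧-conicalˡ (count (u ==_) w ≡ᵇ 2) _ (all-sound _ p u))) tt)
  ; crossing = λ u v u≢v → trans (sym (K≡ u v)) (agree-sound _ _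
      (subst (λ b → (if b then true else agree (K u v) (pairs (u ==_) (v ==_) w)) ≡ true) (≢⇒== u≢v)
        (all-sound _ (∧-conicalʳ (count (u ==_) w ≡ᵇ 2) _ (all-sound _ p u)) v)))
  }

-- Five letters twice each take ten places, of which the two prescribed letters leave 8. The
-- beginning is passed in reverse, as the search keeps words reversed.
solvable : Triangular 5 → Bool
solvable t = maybe (λ x → check (entry t) (0F ∷ 1F ∷ reverse x)) false
                   (Search.search (entry t) (1F ∷ 0F ∷ []) 8 [])

-- Evaluation over all 2^10 labelled graphs. Since every labelling is covered, any two vertices can
-- be made the first two letters by renaming.
all-solvable : allTriangular solvable ≡ true
all-solvable = refl

realisable-5 : (G : SimpleGraph 5) → Σ (List (Fin 5)) λ w → Realises (0F ∷ 1F ∷ w) G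
realisable-5 G with Search.search (entry (triangle G)) (1F ∷ 0F ∷ []) 8 []
                  | allTriangular-sound solvable all-solvable (triangle G)
... | just x | p = reverse x , check-sound G _ (entry-triangle G) _ p

-- With the letters 0 and 1 of K consecutive, a new letter fits around any
-- subset of them.
module _ (G : SimpleGraph (suc (suc (suc n)))) (w : List (Fin (suc (suc n))))
         (r : Realises (0F ∷ 1F ∷ w) (pullback G suc))
         (far : ∀ i → adj G 0F (suc (suc (suc i))) ≡ false)
  where

  w⁺ : List (Fin (suc (suc (suc n))))
  w⁺ = map suc w

  -- The old letters 0 and 1 have become `1F` and `2F`. Their other copies lie in `w⁺`, so each
  -- crosses the new letter `0F` exactly when it stands between the two copies of `0F`.
  insert : Bool → Bool → List (Fin (suc (suc (suc n))))
  insert true  true  = 0F ∷ 1F ∷ 2F ∷ 0F ∷ w⁺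
  insert true  false = 0F ∷ 1F ∷ 0F ∷ 2F ∷ w⁺
  insert false true  = 1F ∷ 0F ∷ 2F ∷ 0F ∷ w⁺
  insert false false = 0F ∷ 0F ∷ 1F ∷ 2F ∷ w⁺

  insert-count : ∀ a b v → count (suc v ==_) (insert a b) ≡ count (v ==_) (0F ∷ 1F ∷ w)
  insert-count a b v = trans (lemma a b) (cong f (count-map suc (suc v ==_) w))
    where
    f : ℕ → ℕ
    f k = if v == 0F then suc (if v == 1F then suc k else k) else (if v == 1F then suc k else k)
    lemma : ∀ a b → count (suc v ==_) (insert a b) ≡ f (count (suc v ==_) w⁺)
    lemma true  true  = refl
    lemma true  false = refl
    lemma false true  = refl
    lemma false false = refl

  w⁺-avoids-0 : count (0F ==_) w⁺ ≡ 0
  w⁺-avoids-0 = trans (count-map suc (0F ==_) w) (avoid w)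
    where
    avoid : (xs : List (Fin (suc (suc n)))) → count (λ i → 0F == suc i) xs ≡ 0
    avoid []       = refl
    avoid (x ∷ xs) = avoid xs

  insert-pairs : ∀ a b u v → pairs (suc u ==_) (suc v ==_) (insert a b) ≡ pairs (u ==_) (v ==_) (0F ∷ 1F ∷ w)
  insert-pairs a b u v = trans (lemma a b)
      (cong₂ f (parity-map suc (suc v ==_) w) (pairs-map suc (suc u ==_) (suc v ==_) w))
    where
    f : Bool → Bool → Bool
    f x y = ((u == 0F) ∧ ((v == 1F) xor x)) xor (((u == 1F) ∧ x) xor y)
    lemma : ∀ a b → pairs (suc u ==_) (suc v ==_) (insert a b)
                  ≡ f (parity (suc v ==_) w⁺) (pairs (suc u ==_) (suc v ==_) w⁺)
    lemma true  true  = refl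
    lemma true  false = refl
    lemma false true  = refl
    lemma false false = refl

  insert-pairs-0 : ∀ a b v → pairs (0F ==_) (suc v ==_) (insert a b) ≡ (a ∧ (v == 0F)) xor (b ∧ (v == 1F))
  insert-pairs-0 a b v = lemma a b
    where
    x = v == 0F
    y = v == 1F
    P = parity (suc v ==_) w⁺
    N = pairs (0F ==_) (suc v ==_) w⁺
    N₀ : N ≡ false
    N₀ = count-zero⇒pairs (0F ==_) (suc v ==_) w⁺ w⁺-avoids-0
    lemma : ∀ a b → pairs (0F ==_) (suc v ==_) (insert a b) ≡ (a ∧ x) xor (b ∧ y)
    lemma true true = trans
      (solve 4 (λ x y P N → (x :+ (y :+ P)) :+ (P :+ N) := (x :+ y) :+ N) refl x y P N)
      (xor-false _ N₀)
    lemma true false = trans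
      (solve 4 (λ x y P N → (x :+ (y :+ P)) :+ ((y :+ P) :+ N) := (x :+ con false) :+ N) refl x y P N)
      (xor-false _ N₀)
    lemma false true = trans
      (solve 3 (λ y P N → (y :+ P) :+ (P :+ N) := y :+ N) refl y P N)
      (xor-false _ N₀)
    lemma false false = trans
      (solve 4 (λ x y P N → (x :+ (y :+ P)) :+ ((x :+ (y :+ P)) :+ N) := N) refl x y P N)
      N₀

  neighbourhood : ∀ v → adj G 0F (suc v) ≡ (adj G 0F 1F ∧ (v == 0F)) xor (adj G 0F 2F ∧ (v == 1F))
  neighbourhood zero =
    solve 2 (λ a b → a := (a :* con true) :+ (b :* con false)) refl (adj G 0F 1F) (adj G 0F 2F)
  neighbourhood (suc zero) =
    solve 2 (λ a b → b := (a :* con false) :+ (b :* con true)) refl (adj G 0F 1F) (adj G 0F 2F)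
  neighbourhood (suc (suc v)) = trans (far v)
    (solve 2 (λ a b → con false := (a :* con false) :+ (b :* con false)) refl (adj G 0F 1F) (adj G 0F 2F))

  private
    a = adj G 0F 1F
    b = adj G 0F 2F

  insert-twice : ∀ v → count (v ==_) (insert a b) ≡ 2
  insert-twice (suc v) = trans (insert-count a b v) (twice r v)
  insert-twice zero    with a | b
  ... | true  | true  = cong (2 +_) w⁺-avoids-0
  ... | true  | false = cong (2 +_) w⁺-avoids-0
  ... | false | true  = cong (2 +_) w⁺-avoids-0
  ... | false | false = cong (2 +_) w⁺-avoids-0

  insert-crossing : ∀ u v → u ≢ v → adj G u v ≡ pairs (u ==_) (v ==_) (insert a b)
  insert-crossing zero    zero    u≢v = contradiction refl u≢v
  insert-crossing zero    (suc v) u≢v = trans (neighbourhood v) (sym (insert-pairs-0 a b v))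
  insert-crossing (suc u) zero    u≢v = begin
    adj G (suc u) 0F
      ≡⟨ adj-sym G (suc u) 0F ⟩
    adj G 0F (suc u)
      ≡⟨ insert-crossing 0F (suc u) (λ ()) ⟩
    pairs (0F ==_) (suc u ==_) (insert a b)
      ≡⟨ pairs-sym (==-exclusive (u≢v ∘ sym)) (insert a b) ⟩
    pairs (suc u ==_) (0F ==_) (insert a b) xor
      (parity (0F ==_) (insert a b) ∧ parity (suc u ==_) (insert a b))
      ≡⟨ xor-false _ (cong (_∧ parity (suc u ==_) (insert a b)) even₀) ⟩
    pairs (suc u ==_) (0F ==_) (insert a b) ∎
    where
    open ≡-Reasoning
    even₀ : parity (0F ==_) (insert a b) ≡ false
    even₀ = trans (sym (odd-count _ (insert a b))) (cong odd (insert-twice 0F))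
  insert-crossing (suc u) (suc v) u≢v =
    trans (crossing r u v (u≢v ∘ cong suc)) (sym (insert-pairs a b u v))

  realisable-insert : Realisable G
  realisable-insert = insert a b , record { twice = insert-twice ; crossing = insert-crossing }

-- Placing a graph among six vertices

extend : (Fin n → Fin m) → SimpleGraph n → SimpleGraph m
extend {n} {m} ι G = record
  { adj        = λ x y → adjacent (preimage x) (preimage y)
  ; adj-sym    = λ x y → adjacent-sym (preimage x) (preimage y)
  ; adj-irrefl = λ x → adjacent-irrefl (preimage x)
  }
  where
  preimage : Fin m → Maybe (Fin n)
  preimage x with any? (λ u → ι u ≟ x)
  ... | yes (u , _) = just u
  ... | no _        = nothing
  adjacent : Maybe (Fin n) → Maybe (Fin n) → Bool
  adjacent (just u) (just v) = adj G u v
  adjacent _        _        = false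
  adjacent-sym : ∀ p q → adjacent p q ≡ adjacent q p
  adjacent-sym (just u) (just v) = adj-sym G u v
  adjacent-sym (just u) nothing  = refl
  adjacent-sym nothing  (just v) = refl
  adjacent-sym nothing  nothing  = refl
  adjacent-irrefl : ∀ p → adjacent p p ≡ false
  adjacent-irrefl (just u) = adj-irrefl G u
  adjacent-irrefl nothing  = refl

module _ (ι : Fin n → Fin m) (ι-injective : ∀ {u v} → ι u ≡ ι v → u ≡ v) (G : SimpleGraph n) where

  extend-induces : ∀ u v → adj G u v ≡ adj (extend ι G) (ι u) (ι v)
  extend-induces u v with any? (λ s → ι s ≟ ι u) | any? (λ s → ι s ≟ ι v)
  ... | no ∄ | _ = contradiction (u , refl) ∄
  ... | yes _ | no ∄ = contradiction (v , refl) ∄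
  ... | yes (s , p) | yes (t , q) = sym (cong₂ (adj G) (ι-injective p) (ι-injective q))

  extend-absent : ∀ x y → (∀ u v → ι u ≡ x → ι v ≡ y → adj G u v ≡ false) → adj (extend ι G) x y ≡ false
  extend-absent x y absent with any? (λ s → ι s ≟ x) | any? (λ s → ι s ≟ y)
  ... | no _        | _           = refl
  ... | yes _       | no _        = refl
  ... | yes (s , p) | yes (t , q) = absent s t p q

-- Places missed by `ι` are filled with isolated vertices. Place 0 holds the letter to be inserted,
-- whose neighbours may only be in places 1 and 2; the word for places 1 to 5 comes from the search.
realisable-via : (G : SimpleGraph n) (ι : Fin n → Fin 6) → (∀ {u v} → ι u ≡ ι v → u ≡ v) →
  (∀ u v → ι u ≡ 0F → 3 ≤ toℕ (ι v) → adj G u v ≡ false) → Realisable G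
realisable-via G ι ι-injective far =
  realisable-induced ι ι-injective (extend-induces ι ι-injective G)
    (realisable-insert G⁺ (proj₁ rest) (proj₂ rest)
      λ i → extend-absent ι ι-injective G 0F _ λ u v p q →
              far u v p (≤-trans (s≤s (s≤s (s≤s z≤n))) (≤-reflexive (cong toℕ (sym q)))))
  where
  G⁺ = extend ι G
  rest = realisable-5 (pullback G⁺ suc)

-- Place 0 stays free, so the condition on its neighbours is vacuous.
realisable-≤5 : n ≤ 5 → (G : SimpleGraph n) → Realisable G
realisable-≤5 n≤5 G = realisable-via G (λ u → suc (inject≤ u n≤5))
  (λ p → inject≤-injective n≤5 n≤5 _ _ (Fin.suc-injective p)) (λ u v ())

-- Around the arrangement of the tail, the head is put first if it is a member and last otherwise.
members-first : (p : Subset n) → Σ (Fin n → Fin n) λ ι →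
  (∀ {u v} → ι u ≡ ι v → u ≡ v) × (∀ {u} → u ∈ p → toℕ (ι u) < ∣ p ∣)
members-first [] = (λ ()) , (λ {u} → ⊥-elim (Fin.¬Fin0 u)) , λ ()
members-first (inside ∷ p) with members-first p
... | ι , inj , bound = ι′ , inj′ , bound′
  where
  ι′ : Fin (suc _) → Fin (suc _)
  ι′ zero    = zero
  ι′ (suc u) = suc (ι u)
  inj′ : ∀ {u v} → ι′ u ≡ ι′ v → u ≡ v
  inj′ {zero}  {zero}  _  = refl
  inj′ {zero}  {suc v} ()
  inj′ {suc u} {zero}  ()
  inj′ {suc u} {suc v} e  = cong suc (inj (Fin.suc-injective e))
  bound′ : ∀ {u} → u ∈ inside ∷ p → toℕ (ι′ u) < suc ∣ p ∣
  bound′ here        = s≤s z≤n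
  bound′ (there u∈p) = s≤s (bound u∈p)
members-first {suc n} (outside ∷ p) with members-first p
... | ι , inj , bound = ι′ , inj′ , bound′
  where
  ι′ : Fin (suc _) → Fin (suc _)
  ι′ zero    = fromℕ n
  ι′ (suc u) = inject₁ (ι u)
  inj′ : ∀ {u v} → ι′ u ≡ ι′ v → u ≡ v
  inj′ {zero}  {zero}  _ = refl
  inj′ {zero}  {suc v} e = contradiction e fromℕ≢inject₁
  inj′ {suc u} {zero}  e = contradiction (sym e) fromℕ≢inject₁
  inj′ {suc u} {suc v} e = cong suc (inj (inject₁-injective e))
  bound′ : ∀ {u} → u ∈ outside ∷ p → toℕ (ι′ u) < ∣ p ∣
  bound′ (there {x = u} u∈p) = subst (_< ∣ p ∣) (sym (toℕ-inject₁ (ι _))) (bound u∈p)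

transpose-left : (i j : Fin n) → transpose i j i ≡ j
transpose-left i j rewrite dec-true (i ≟ i) refl = refl

transpose-injective : (i j : Fin n) {u v : Fin n} → transpose i j u ≡ transpose i j v → u ≡ v
transpose-injective i j e =
  trans (sym (transpose-inverse j i)) (trans (cong (transpose j i) e) (transpose-inverse j i))

transpose-bound : ∀ {k} (i j u : Fin n) → toℕ i < k → toℕ j < k → toℕ u < k → toℕ (transpose i j u) < k
transpose-bound i j u i< j< u< with does (u ≟ i)
... | true  = j<
... | false with does (u ≟ j)
...   | true  = i<
...   | false = u<

-- The closed neighbourhood of `v` has at most three members, which `members-first` moves to the
-- places 0, 1 and 2. A transposition within these places brings `v` to place 0 and leaves its
-- neighbours in places 1 and 2.
realisable-degree≤2 : (G : SimpleGraph 6) (v : Fin 6) → degree G v ≤ 2 → Realisable G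
realisable-degree≤2 G v deg≤2 = realisable-via G ι
    (λ e → order-injective (transpose-injective _ 0F e)) far
  where
  closed : Subset 6
  closed = tabulate (adj G v) [ v ]≔ inside
  order = proj₁ (members-first closed)
  order-injective = λ {u} {v} → proj₁ (proj₂ (members-first closed)) {u} {v}
  order-bound : ∀ {u} → u ∈ closed → toℕ (order u) < 3
  order-bound u∈ = ≤-trans (proj₂ (proj₂ (members-first closed)) u∈)
                           (≤-trans ([]≔-∣∣ (tabulate (adj G v)) v) (s≤s deg≤2))
  ι : Fin 6 → Fin 6
  ι u = transpose (order v) 0F (order u)
  far : ∀ u w → ι u ≡ 0F → 3 ≤ toℕ (ι w) → adj G u w ≡ false
  far u w ιu≡0 3≤ with order-injective (transpose-injective (order v) 0F
                         (trans ιu≡0 (sym (transpose-left (order v) 0F))))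
  ... | refl with adj G v w in e
  ...   | false = refl
  ...   | true  = contradiction 3≤ (<⇒≱ (transpose-bound (order v) 0F (order w)
            (order-bound (∈-[]≔ _ v)) (s≤s z≤n)
            (order-bound (∈-[]≔⁺ _ v (lookup⇒[]= w _ (trans (lookup∘tabulate (adj G v) w) e))))))

-- The equivalence of the three properties

transverse⇒lowered : {G : SimpleGraph n} {S : Subset (3 * n)} → TransverseCircuit G S → ∣ S ∣ ≤ 3 →
  Σ (List (Fin n)) λ vs → Σ (Fin n) λ v → degree (foldl _✶_ G vs) v ≤ 2
transverse⇒lowered {n} {G} {S} circuit ∣S∣≤3 with lower _ (transverse⇒confined {G = G} circuit) ≤-refl
... | vs , v , deg< = vs , v , s≤s⁻¹ (≤-trans deg< (≤-trans (∣projection∣ {n} S) ∣S∣≤3))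

corollary9 : ∀ (n : ℕ) .{{_ : NonZero n}} → n ≤ 6 → (G : SimpleGraph n) →
    (CircleGraph G ⇔ (Σ (Subset (3 * n)) λ S → TransverseCircuit G S × ∣ S ∣ ≤ 3)) ×
    ((Σ (Subset (3 * n)) λ S → TransverseCircuit G S × ∣ S ∣ ≤ 3) ⇔
    (Σ (SimpleGraph n) λ H → LocallyEquivalent G H × Σ (Fin n) λ v → degree H v ≤ 2))
corollary9 n n≤6 G = mk⇔ 1⇒2 2⇒1 , mk⇔ 2⇒3 3⇒2
  where
  short : ∀ {S} → Confined G S → ∣ S ∣ ≤ 3 → Σ (Subset (3 * n)) λ S → TransverseCircuit G S × ∣ S ∣ ≤ 3
  short X ∣S∣≤3 = let C , circuit , ∣C∣≤∣S∣ = confined⇒transverse X in C , circuit , ≤-trans ∣C∣≤∣S∣ ∣S∣≤3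

  1⇒2 : CircleGraph G → _
  1⇒2 circle = let S , X , ∣S∣≤3 = realisable⇒confined n≤6 (circle⇒realisable circle) in short X ∣S∣≤3

  2⇒1 : _ → CircleGraph G
  2⇒1 (S , circuit , ∣S∣≤3) with m≤n⇒m<n∨m≡n n≤6
  ... | inj₁ n<6  = realisable⇒circle (realisable-≤5 (s≤s⁻¹ n<6) G)
  -- With six vertices, a word is found after local complementation and carried back, as each
  -- complementation is an involution.
  ... | inj₂ refl = let vs , v , deg≤2 = transverse⇒lowered {G = G} circuit ∣S∣≤3 in
    realisable⇒circle (realisable-✶⁻ vs (realisable-degree≤2 (foldl _✶_ G vs) v deg≤2))

  2⇒3 : _ → Σ (SimpleGraph n) λ H → LocallyEquivalent G H × Σ (Fin n) λ v → degree H v ≤ 2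
  2⇒3 (S , circuit , ∣S∣≤3) = let vs , v , deg≤2 = transverse⇒lowered {G = G} circuit ∣S∣≤3 in
    foldl _✶_ G vs , (vs , λ _ _ → refl) , v , deg≤2

  3⇒2 : _ → Σ (Subset (3 * n)) λ S → TransverseCircuit G S × ∣ S ∣ ≤ 3
  3⇒2 (H , (vs , G✶≈H) , v , deg≤2) =
    -- A closed neighbourhood has one vertex more than the degree, which turns the bound two into
    -- three.
    short (confined-✶⁻ vs (confined-≈ {G = H} (λ s t → sym (G✶≈H s t)) (confined-neighbourhood H v)))
          (≤-trans ([]≔-∣∣ (tabulate (adj H v)) v) (s≤s deg≤2))
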